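{- For every integer $n\ge 0$, \[ d_{n,q}(x)=\sum_{l=0}^{n}\Bigg(\sum_{m=l}^{n}(-1)^m\frac{2^{2m-l}}{m!}S_1(m,l)\,d_{n-m,q}\Bigg)x^l. \]
   Context: Let $p$ be a fixed odd prime, $\mathbb{C}_p$ the completion of the algebraic closure of $\mathbb{Q}_p$, with $|p|_p=1/p$. Let $q\in\mathbb{C}_p$ with $|1-q|_p<p^{ -1/(p-1)}$, and $\log$ the $p$-adic logarithm. The numbers $d_{n,q}$ are defined by \[ \frac{q-1+\frac{q-1}{\log q}\cdot\frac12\log(1-4t)}{q\sqrt{1-4t}-1}=\sum_{n=0}^{\infty}d_{n,q}t^n, \] and the ($q$-analogue) Catalan–Daehee polynomials $d_{n,q}(x)$ are defined by \[ \frac{q-1+\frac{q-1}{\log q}\cdot\frac12\log(1-4t)}{q\sqrt{1-4t}-1}(1-4t)^{x/2}=\sum_{n=0}^{\infty}d_{n,q}(x)t^n, \] for $t\in\mathbb{C}_p$ with $|t|_p<p^{ -1/(p-1)}$, where $(1-4t)^{x/2}=\exp\big(\tfrac{x}{2}\log(1-4t)\big)$. $S_1(m,l)$ are the Stirling numbers of the first kind: $(x)_m=\sum_{l=0}^m S_1(m,l)x^l$, with $(x)_0=1$, $(x)_m=x(x-1)\cdots(x-m+1)$. -}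

module Defs where

open import Level using (Level; _⊔_) renaming (suc to lsuc)
open import Algebra.Bundles using (CommutativeRing)
import Algebra.Definitions.RawMonoid
import Algebra.Properties.Semiring.Exp
import Algebra.Properties.Semiring.Sum
open import Data.Fin.Base using (Fin; toℕ)
open import Data.Integer.Base as ℤ using (ℤ; -[1+_]) renaming (+_ to pos)
import Data.Integer.Properties as ℤ
open import Data.Nat.Base as ℕ using (ℕ; zero; suc; _∸_; _≥_; 2+; _!)
open import Data.Nat.Primality using (Prime; prime)
open import Data.Product.Base using (Σ-syntax; ∃-syntax; _×_)
open import Data.Rational.Base as ℚ using (ℚ; 1ℚ)
open import Function.Bundles using (_⇔_)
open import Relation.Binary.Construct.Add.Supremum.NonStrict ℚ._≤_ using (_≤⁺_)
open import Relation.Binary.Construct.Add.Supremum.Strict ℚ._<_ using (_<⁺_)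
open import Relation.Binary.PropositionalEquality.Core using (_≡_)
open import Relation.Nullary.Construct.Add.Supremum using (_⁺; [_]; ⊤⁺)
open import Relation.Nullary.Negation using (¬_)

infixl 6 _+⁺_

_+⁺_ : ℚ ⁺ → ℚ ⁺ → ℚ ⁺
[ r ] +⁺ [ s ] = [ r ℚ.+ s ]
[ _ ] +⁺ ⊤⁺    = ⊤⁺
⊤⁺    +⁺ _     = ⊤⁺

-- A field with a non-archimedean absolute value whose value group lies in p^ℚ,
-- written additively: |x| = p^(- v x), and v 0 = ⊤⁺.
-- The value of _⁻¹ at 0 is left unspecified.
record ValuedField (c ℓ : Level) : Set (lsuc (c ⊔ ℓ)) where
  field
    commutativeRing : CommutativeRing c ℓ

  open CommutativeRing commutativeRing public

  infix 8 _⁻¹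

  field
    _⁻¹      : Carrier → Carrier
    ⁻¹-cong  : ∀ {x y} → x ≈ y → x ⁻¹ ≈ y ⁻¹
    inverseʳ : ∀ x → ¬ x ≈ 0# → x * x ⁻¹ ≈ 1#
    1≉0      : ¬ 1# ≈ 0#

    v      : Carrier → ℚ ⁺
    v-cong : ∀ {x y} → x ≈ y → v x ≡ v y
    v-⊤    : ∀ x → v x ≡ ⊤⁺ ⇔ x ≈ 0#
    v-*    : ∀ x y → v (x * y) ≡ v x +⁺ v y
    v-+    : ∀ x y r → r ≤⁺ v x → r ≤⁺ v y → r ≤⁺ v (x + y)

  open Algebra.Properties.Semiring.Exp semiring public using (_^_)
  open Algebra.Properties.Semiring.Sum semiring public using (sum)
  open Algebra.Definitions.RawMonoid +-rawMonoid
    using () renaming (_×_ to _times_)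

  infixl 7 _/_

  _/_ : Carrier → Carrier → Carrier
  x / y = x * y ⁻¹

  fromℕ : ℕ → Carrier
  fromℕ n = n times 1#

  fromℤ : ℤ → Carrier
  fromℤ (pos n)   = fromℕ n
  fromℤ -[1+ n ] = - fromℕ (suc n)

  fromℚ : ℚ → Carrier
  fromℚ r = fromℤ (ℚ.↥ r) / fromℕ (ℚ.↧ₙ r)

  ConvergesTo : (ℕ → Carrier) → Carrier → Set
  ConvergesTo s x =
    ∀ (r : ℚ) → ∃[ N ] (∀ n → n ≥ N → [ r ] ≤⁺ v (s n - x))

  IsCauchy : (ℕ → Carrier) → Set
  IsCauchy s =
    ∀ (r : ℚ) → ∃[ N ] (∀ m n → m ≥ N → n ≥ N → [ r ] ≤⁺ v (s m - s n))

  HasSum : (ℕ → Carrier) → Carrier → Set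
  HasSum a = ConvergesTo (λ N → sum {N} (λ i → a (toℕ i)))

  evalMonic : ∀ {n} → (Fin n → Carrier) → Carrier → Carrier
  evalMonic {n} a x = x ^ n + sum (λ i → a i * x ^ toℕ i)

  -- The closure of ℚ. When the field is complete and v extends the p-adic
  -- valuation this is ℚₚ, and Algebraic below is the algebraic closure of ℚₚ
  -- inside the field.
  InClosureOfℚ : Carrier → Set
  InClosureOfℚ x = Σ[ s ∈ (ℕ → ℚ) ] ConvergesTo (λ n → fromℚ (s n)) x

  Algebraic : Carrier → Set (c ⊔ ℓ)
  Algebraic x =
    ∃[ n ] Σ[ a ∈ (Fin n → Carrier) ]
      (∀ i → InClosureOfℚ (a i)) × evalMonic a x ≈ 0#

-- ℂₚ as the completion of an algebraic closure of ℚₚ. These conditions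
-- determine the valued field up to isomorphism.
record PAdicComplexNumbers (p : ℕ) (c ℓ : Level) : Set (lsuc (c ⊔ ℓ)) where
  field
    valuedField : ValuedField c ℓ

  open ValuedField valuedField public

  field
    v-p      : v (fromℕ p) ≡ [ 1ℚ ]
    complete : ∀ s → IsCauchy s → ∃[ x ] ConvergesTo s x
    algebraicallyClosed :
      ∀ {n} (a : Fin (suc n) → Carrier) → (∀ i → Algebraic (a i)) →
      ∃[ x ] Algebraic x × evalMonic a x ≈ 0#
    algebraicDense :
      ∀ x (r : ℚ) → ∃[ y ] Algebraic y × [ r ] ≤⁺ v (x - y)

1/[_-1] : ∀ {p} → Prime p → ℚ
1/[_-1] {2+ k} _ = pos 1 ℚ./ suc k
1/[_-1] {0} (prime {{()}} _)
1/[_-1] {1} (prime {{()}} _)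

-- Polynomials over ℤ as coefficient sequences.
private
  module ℤSum = Algebra.Properties.Semiring.Sum ℤ.+-*-semiring

infixl 7 _⊛_

_⊛_ : (ℕ → ℤ) → (ℕ → ℤ) → (ℕ → ℤ)
(f ⊛ g) n = ℤSum.sum {suc n} (λ i → f (toℕ i) ℤ.* g (n ∸ toℕ i))

one : ℕ → ℤ
one zero    = pos 1
one (suc _) = pos 0

X-_ : ℕ → (ℕ → ℤ)
(X- a) zero          = ℤ.- pos a
(X- a) (suc zero)    = pos 1
(X- a) (suc (suc _)) = pos 0

fallingFactorial : ℕ → (ℕ → ℤ)
fallingFactorial zero    = one
fallingFactorial (suc m) = fallingFactorial m ⊛ (X- m)

S₁ : ℕ → ℕ → ℤ
S₁ m l = fallingFactorial m l

module CatalanDaehee {c ℓ} {p : ℕ} (p-prime : Prime p)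
                     (ℂₚ : PAdicComplexNumbers p c ℓ) where

  open PAdicComplexNumbers ℂₚ public

  -- |z| < p^(-1/(p-1))
  InDisc : Carrier → Set
  InDisc z = [ 1/[ p-prime -1] ] <⁺ v z

  sumFromTo : ℕ → ℕ → (ℕ → Carrier) → Carrier
  sumFromTo a b f = sum {suc b ∸ a} (λ j → f (a ℕ.+ toℕ j))

  infixl 5 sumFromTo
  syntax sumFromTo a b (λ i → t) = ∑[ i from a to b ] t

  IsLog : Carrier → Carrier → Set
  IsLog x y = HasSum (λ n → (- 1#) ^ n * ((x - 1#) ^ suc n / fromℕ (suc n))) y

  IsExp : Carrier → Carrier → Set
  IsExp x y = HasSum (λ n → x ^ n / fromℕ (n !)) y

  -- z is x raised to the power y, i.e. exp (y log x).
  IsPower : Carrier → Carrier → Carrier → Set c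
  IsPower x y z = ∃[ l ] IsLog x l × IsExp (y * l) z

  ½ : Carrier
  ½ = 1# / fromℕ 2

  1-4_ : Carrier → Carrier
  1-4 t = 1# - fromℕ 4 * t

  -- y is the value at t of the quotient generating the d_{n,q}. It has no value
  -- where the denominator vanishes (a removable singularity).
  GeneratingValue : (q logq t y : Carrier) → Set (c ⊔ ℓ)
  GeneratingValue q logq t y =
    ∃[ l ] ∃[ s ] IsLog (1-4 t) l × IsPower (1-4 t) ½ s ×
      (¬ q * s - 1# ≈ 0#) ×
      y ≈ ((q - 1#) + (q - 1#) / logq * (½ * l)) / (q * s - 1#)

  IsCatalanDaeheeNumbers : (q logq : Carrier) → (ℕ → Carrier) → Set (c ⊔ ℓ)
  IsCatalanDaeheeNumbers q logq d =
    ∀ t y → InDisc t → GeneratingValue q logq t y →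
    HasSum (λ n → d n * t ^ n) y

  -- For |x| > 1 the power series exp ((x/2) log (1-4t)) converges only for t in
  -- a smaller disc; the identity is required exactly where it converges.
  IsCatalanDaeheePolynomials :
    (q logq : Carrier) → (ℕ → Carrier → Carrier) → Set (c ⊔ ℓ)
  IsCatalanDaeheePolynomials q logq d =
    ∀ x t y e → InDisc t → GeneratingValue q logq t y →
    IsPower (1-4 t) (x / fromℕ 2) e →
    HasSum (λ n → d n x * t ^ n) (y * e)

{-# OPTIONS --safe #-}
module Submission where

-- For every z, the series of (1 + u)ᶻ = exp (z log (1 + u)) converges once u is small
-- enough, and its m-th coefficient is (z)ₘ / m! = Σₖ S₁(m, k) zᵏ / m!. Formally this
-- rests on (log (1 + u))ᵏ / k! = Σₘ S₁(m, k) uᵐ / m!, proved by comparing derivatives;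
-- analytically, |1 / m!| ≤ pᵐ makes the double series Σₖ Σₘ S₁(m, k) zᵏ uᵐ / m! converge
-- regardless of the order of summation. With u = -4t and z = x / 2, the Cauchy product
-- with Σ dₙ tⁿ is a power series that agrees with Σ dₙ(x) tⁿ at all t = pᵏ, k large, and
-- a power series vanishing at those points is zero. At such t the denominator
-- q √(1 - 4t) - 1 does not vanish, because √(1 - 4t) is closer to 1 than q is.

open import Defs
open import Level using (Level)
open import Algebra.Bundles using (CommutativeRing)
import Algebra.Properties.CommutativeMonoid.Mult
import Algebra.Properties.CommutativeSemiring.Exp
import Algebra.Properties.Ring
import Algebra.Properties.Semiring.Exp
import Algebra.Properties.Semiring.Mult
import Algebra.Properties.Semiring.Sum
import Algebra.Solver.Ring as RingSolver
import Algebra.Solver.Ring.AlmostCommutativeRing as ACR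
open import Data.Fin.Base using (toℕ)
open import Data.Fin.Properties using (toℕ<n)
open import Data.Integer.Base as ℤ using (ℤ; -[1+_]; _⊖_; +≤+; -≤+; +<+) renaming (+_ to pos)
import Data.Integer.Properties as ℤ
open import Data.Maybe.Base using (Maybe; just; nothing)
open import Data.Nat.Base as ℕ using (ℕ; zero; suc; 2+; _∸_; _<_; _≤_; _≥_; s≤s; z≤n; _!)
  renaming (_*_ to _*ℕ_)
open import Data.Nat.Coprimality using (prime⇒coprime; coprime-Bézout)
open import Data.Nat.Divisibility using (_∣_)
import Data.Nat.DivMod as ℕ
open import Data.Nat.GCD using (module Bézout)
open import Data.Nat.Induction using (<-rec)
open import Data.Nat.Primality using (Prime; prime; prime⇒nonZero; prime⇒nonTrivial)
import Data.Nat.Properties as ℕ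
open import Data.Product.Base using (∃-syntax; _,_; proj₁; proj₂) renaming (_×_ to _∧_)
open import Data.Rational.Base as ℚ using (ℚ; 0ℚ; 1ℚ; mkℚ)
import Data.Rational.Properties as ℚ
import Data.Rational.Solver as ℚ
import Data.Rational.Unnormalised.Base as ℚᵘ
import Data.Rational.Unnormalised.Properties as ℚᵘ
open import Data.Sum.Base using (inj₁; inj₂)
open import Function.Base using (_∘_; _$_)
open import Function.Bundles using (Equivalence)
open import Relation.Binary.Construct.Add.Supremum.NonStrict ℚ._≤_ using (_≤⁺_; [_]; _≤⊤⁺; ≤⁺-trans; [≤]-injective)
open import Relation.Binary.Construct.Add.Supremum.Strict ℚ._<_ using (_<⁺_; [_])
open import Relation.Binary.PropositionalEquality.Core as ≡ using (_≡_)
open import Relation.Nullary.Construct.Add.Supremum using ([_]; ⊤⁺; []-injective)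
open import Relation.Nullary.Decidable.Core using (yes; no)
open import Relation.Nullary.Negation using (¬_; contradiction)

-- The hypotheses do not present `d` and `dₓ` formally. They give sums at a point `t`, and only once
-- a logarithm, a square root and a power have been exhibited there and the denominator is known not
-- to vanish. The radius on which this can be done depends on `x` and on `q`, so `x` is fixed and
-- everything happens close to 0; powers of `p` serve as nonzero points tending to 0.
--
-- The required size of `u` is a budget of exponents. If `|z| ≤ p^(-r)` with `r ≤ 0`, the bound
-- `(1 - r) + τ` on the valuation of `u` spends, per degree, 1 on `1 / m!` and `-r` on `zᵏ` with
-- `k ≤ m`, and leaves `τ`. Here `τ ≥ 1` makes the series converge, and `τ` above the valuation of
-- `q - 1`, which is finite because `q ≠ 1`, keeps the denominator away from zero.

-- Finite sums and Cauchy products.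

module FiniteSums {c ℓ} (R : CommutativeRing c ℓ) where
  open CommutativeRing R renaming (zero to *-zero)
  open Algebra.Properties.Semiring.Sum semiring
    using (sum; sum-cong-≋; ∑-distrib-+; ∑-comm; *-distribˡ-sum; *-distribʳ-sum; sum-replicate-zero)
  open import Relation.Binary.Reasoning.Setoid setoid

  ∑ : ℕ → (ℕ → Carrier) → Carrier
  ∑ N a = sum {N} (λ i → a (toℕ i))

  ∑-cong : ∀ N {a b} → (∀ i → i < N → a i ≈ b i) → ∑ N a ≈ ∑ N b
  ∑-cong N a≈b = sum-cong-≋ {N} (λ i → a≈b (toℕ i) (toℕ<n i))

  ∑-zero : ∀ N {a} → (∀ i → i < N → a i ≈ 0#) → ∑ N a ≈ 0#
  ∑-zero N a≈0 = trans (∑-cong N a≈0) (sum-replicate-zero N)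

  ∑-snoc : ∀ N a → ∑ (suc N) a ≈ ∑ N a + a N
  ∑-snoc zero    a = +-comm _ _
  ∑-snoc (suc N) a = trans (+-congˡ (∑-snoc N (a ∘ suc))) (sym (+-assoc _ _ _))

  ∑-+ : ∀ N a b → ∑ N (λ i → a i + b i) ≈ ∑ N a + ∑ N b
  ∑-+ N a b = ∑-distrib-+ {N} (a ∘ toℕ) (b ∘ toℕ)

  ∑-*ˡ : ∀ N x a → x * ∑ N a ≈ ∑ N (λ i → x * a i)
  ∑-*ˡ N x a = *-distribˡ-sum {N} x (a ∘ toℕ)

  ∑-*ʳ : ∀ N x a → ∑ N a * x ≈ ∑ N (λ i → a i * x)
  ∑-*ʳ N x a = *-distribʳ-sum {N} x (a ∘ toℕ)

  ∑-swap : ∀ M N (a : ℕ → ℕ → Carrier) →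
           ∑ M (λ i → ∑ N (a i)) ≈ ∑ N (λ j → ∑ M (λ i → a i j))
  ∑-swap M N a = ∑-comm {M} {N} (λ i j → a (toℕ i) (toℕ j))

  infixl 7 _⋆_

  -- Over ℤ this agrees definitionally with `_⊛_`, so lemmas about it apply directly to
  -- `fallingFactorial`.
  _⋆_ : (ℕ → Carrier) → (ℕ → Carrier) → (ℕ → Carrier)
  (f ⋆ g) n = ∑ (suc n) (λ i → f i * g (n ∸ i))

  ⋆-cong : ∀ {f f′ g g′} → (∀ n → f n ≈ f′ n) → (∀ n → g n ≈ g′ n) →
           ∀ n → (f ⋆ g) n ≈ (f′ ⋆ g′) n
  ⋆-cong f≈f′ g≈g′ n = ∑-cong (suc n) (λ i _ → *-cong (f≈f′ i) (g≈g′ (n ∸ i)))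

  -- `suc n ∸ i` equals `suc (n ∸ i)` only for `i ≤ n`, hence the last term is split off.
  ⋆-suc : ∀ f g n → (f ⋆ g) (suc n) ≈ ∑ (suc n) (λ i → f i * g (suc (n ∸ i))) + f (suc n) * g 0
  ⋆-suc f g n = trans (∑-snoc (suc n) (λ i → f i * g (suc n ∸ i))) $ +-cong
    (∑-cong (suc n) λ i i≤n → reflexive (≡.cong (λ k → f i * g k) (ℕ.+-∸-assoc 1 (ℕ.≤-pred i≤n))))
    (reflexive (≡.cong (λ k → f (suc n) * g k) (ℕ.n∸n≡0 n)))

  -- Passing to partial sums is multiplication of the formal series by `u / (1 - u)`, which may be
  -- moved onto one factor of a product.
  ∑-⋆ : ∀ f g N → ∑ N (f ⋆ g) ≈ (f ⋆ (λ k → ∑ k g)) N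
  ∑-⋆ f g zero    = sym (trans (+-identityʳ _) (zeroʳ _))
  ∑-⋆ f g (suc N) = begin
    ∑ (suc N) (f ⋆ g)                                             ≈⟨ ∑-snoc N (f ⋆ g) ⟩
    ∑ N (f ⋆ g) + (f ⋆ g) N                                       ≈⟨ +-congʳ (∑-⋆ f g N) ⟩
    (f ⋆ G) N + (f ⋆ g) N                                         ≈⟨ ∑-+ (suc N) (λ i → f i * G (N ∸ i)) (λ i → f i * g (N ∸ i)) ⟨
    ∑ (suc N) (λ i → f i * G (N ∸ i) + f i * g (N ∸ i))           ≈⟨ ∑-cong (suc N) (λ i _ → trans (sym (distribˡ (f i) _ _)) (*-congˡ (sym (∑-snoc (N ∸ i) g)))) ⟩
    ∑ (suc N) (λ i → f i * G (suc (N ∸ i)))                       ≈⟨ +-identityʳ _ ⟨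
    ∑ (suc N) (λ i → f i * G (suc (N ∸ i))) + 0#                  ≈⟨ +-congˡ (zeroʳ _) ⟨
    ∑ (suc N) (λ i → f i * G (suc (N ∸ i))) + f (suc N) * G 0     ≈⟨ ⋆-suc f G N ⟨
    (f ⋆ G) (suc N)                                               ∎
    where
    G : ℕ → Carrier
    G k = ∑ k g

  -- For a factor of degree at most one, such as `X - m` in a falling factorial.
  ⋆-linear : ∀ f g → (∀ k → g (suc (suc k)) ≈ 0#) →
             ∀ n → (f ⋆ g) (suc n) ≈ f n * g 1 + f (suc n) * g 0
  ⋆-linear f g g≈0 n = begin
    (f ⋆ g) (suc n)                                                     ≈⟨ ⋆-suc f g n ⟩
    ∑ (suc n) (λ i → f i * g (suc (n ∸ i))) + f (suc n) * g 0           ≈⟨ +-congʳ (∑-snoc n (λ i → f i * g (suc (n ∸ i)))) ⟩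
    ∑ n (λ i → f i * g (suc (n ∸ i))) + f n * g (suc (n ∸ n)) + f (suc n) * g 0
      ≈⟨ +-congʳ (+-cong (∑-zero n vanish) (reflexive (≡.cong (λ k → f n * g (suc k)) (ℕ.n∸n≡0 n)))) ⟩
    0# + f n * g 1 + f (suc n) * g 0                                    ≈⟨ +-congʳ (+-identityˡ _) ⟩
    f n * g 1 + f (suc n) * g 0                                         ∎
    where
    vanish : ∀ i → i < n → f i * g (suc (n ∸ i)) ≈ 0#
    vanish i i<n = trans
      (*-congˡ (trans (reflexive (≡.cong (g ∘ suc) (≡.sym (ℕ.suc-pred (n ∸ i) {{ℕ.>-nonZero (ℕ.m<n⇒0<n∸m i<n)}})))) (g≈0 _)))
      (zeroʳ _)

  -- Multiplication by 1 + u.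
  shift₊ : (ℕ → Carrier) → (ℕ → Carrier)
  shift₊ f zero    = f 0
  shift₊ f (suc n) = f (suc n) + f n

  -- This lemma and the next let `1 + u` be absorbed into either factor, so that it can follow the
  -- derivative in each summand of the Leibniz rule.
  shift₊-⋆ˡ : ∀ f g n → (shift₊ f ⋆ g) (suc n) ≈ (f ⋆ g) (suc n) + (f ⋆ g) n
  shift₊-⋆ˡ f g n = begin
    f 0 * g (suc n) + ∑ (suc n) (λ i → (f (suc i) + f i) * g (n ∸ i))
      ≈⟨ +-congˡ (trans (∑-cong (suc n) (λ i _ → distribʳ (g (n ∸ i)) (f (suc i)) (f i)))
                        (∑-+ (suc n) (λ i → f (suc i) * g (n ∸ i)) (λ i → f i * g (n ∸ i)))) ⟩
    f 0 * g (suc n) + (∑ (suc n) (λ i → f (suc i) * g (n ∸ i)) + (f ⋆ g) n)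
      ≈⟨ +-assoc _ _ _ ⟨
    (f ⋆ g) (suc n) + (f ⋆ g) n ∎

  shift₊-⋆ʳ : ∀ f g n → (f ⋆ shift₊ g) (suc n) ≈ (f ⋆ g) (suc n) + (f ⋆ g) n
  shift₊-⋆ʳ f g n = begin
    (f ⋆ shift₊ g) (suc n)
      ≈⟨ ⋆-suc f (shift₊ g) n ⟩
    ∑ (suc n) (λ i → f i * (g (suc (n ∸ i)) + g (n ∸ i))) + f (suc n) * g 0
      ≈⟨ +-congʳ (trans (∑-cong (suc n) (λ i _ → distribˡ (f i) (g (suc (n ∸ i))) (g (n ∸ i))))
                        (∑-+ (suc n) (λ i → f i * g (suc (n ∸ i))) (λ i → f i * g (n ∸ i)))) ⟩
    ∑ (suc n) (λ i → f i * g (suc (n ∸ i))) + (f ⋆ g) n + f (suc n) * g 0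
      ≈⟨ trans (+-assoc _ _ _) (trans (+-congˡ (+-comm _ _)) (sym (+-assoc _ _ _))) ⟩
    ∑ (suc n) (λ i → f i * g (suc (n ∸ i))) + f (suc n) * g 0 + (f ⋆ g) n
      ≈⟨ +-congʳ (⋆-suc f g n) ⟨
    (f ⋆ g) (suc n) + (f ⋆ g) n ∎

-- Stirling numbers of the first kind.

private module ℤΣ = FiniteSums ℤ.+-*-commutativeRing

S₁-suc-zero : ∀ m → S₁ (suc m) 0 ≡ S₁ m 0 ℤ.* (ℤ.- pos m)
S₁-suc-zero m = ℤ.+-identityʳ _

-- The coefficient of `X^(k+1)` in `(X)ₘ · (X - m)`.
S₁-suc-suc : ∀ m k → S₁ (suc m) (suc k) ≡ S₁ m k ℤ.+ S₁ m (suc k) ℤ.* (ℤ.- pos m)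
S₁-suc-suc m k = ≡.trans (ℤΣ.⋆-linear (S₁ m) (X- m) (λ _ → ≡.refl) k)
                         (≡.cong (ℤ._+ S₁ m (suc k) ℤ.* (ℤ.- pos m)) (ℤ.*-identityʳ (S₁ m k)))

S₁-zero : ∀ m → S₁ (suc m) 0 ≡ pos 0
S₁-zero zero    = ≡.refl
S₁-zero (suc m) = ≡.trans (S₁-suc-zero (suc m)) (≡.cong (ℤ._* (ℤ.- pos (suc m))) (S₁-zero m))

S₁-vanish : ∀ {m k} → m < k → S₁ m k ≡ pos 0
S₁-vanish {zero}  {suc k} _         = ≡.refl
S₁-vanish {suc m} {suc k} (s≤s m<k) = ≡.trans (S₁-suc-suc m k)
  (≡.cong₂ (λ a b → a ℤ.+ b ℤ.* (ℤ.- pos m)) (S₁-vanish m<k) (S₁-vanish (ℕ.m<n⇒m<1+n m<k)))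

-- The ring homomorphism from ℤ and a ring solver over it.

module FieldLemmas {c ℓ} (F : ValuedField c ℓ) where
  open ValuedField F renaming (zero to *-zero)
  open Algebra.Properties.Semiring.Mult semiring using (×-homo-+; ×1-homo-*)
  open Algebra.Properties.Ring ring using (-‿distribˡ-*; -‿involutive; -0#≈0#; -‿+-comm)
  open import Relation.Binary.Reasoning.Setoid setoid

  fromℕ-+ : ∀ m n → fromℕ (m ℕ.+ n) ≈ fromℕ m + fromℕ n
  fromℕ-+ = ×-homo-+ 1#

  fromℕ-* : ∀ m n → fromℕ (m ℕ.* n) ≈ fromℕ m * fromℕ n
  fromℕ-* = ×1-homo-*

  fromℕ-1 : fromℕ 1 ≈ 1#
  fromℕ-1 = +-identityʳ 1#

  private
    cancel-1 : ∀ x y → (1# + x) - (1# + y) ≈ x - y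
    cancel-1 x y = begin
      (1# + x) + - (1# + y)   ≈⟨ +-cong (+-comm _ _) (sym (-‿+-comm _ _)) ⟩
      (x + 1#) + (- 1# - y)   ≈⟨ +-assoc _ _ _ ⟩
      x + (1# + (- 1# - y))   ≈⟨ +-congˡ (trans (sym (+-assoc _ _ _)) (+-congʳ (-‿inverseʳ 1#))) ⟩
      x + (0# - y)            ≈⟨ +-congˡ (+-identityˡ _) ⟩
      x - y                   ∎

  fromℤ-⊖ : ∀ m n → fromℤ (m ⊖ n) ≈ fromℕ m - fromℕ n
  fromℤ-⊖ m       zero    = sym (trans (+-congˡ -0#≈0#) (+-identityʳ _))
  fromℤ-⊖ zero    (suc n) = sym (+-identityˡ _)
  fromℤ-⊖ (suc m) (suc n) = begin
    fromℤ (suc m ⊖ suc n)     ≡⟨ ≡.cong fromℤ (ℤ.[1+m]⊖[1+n]≡m⊖n m n) ⟩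
    fromℤ (m ⊖ n)             ≈⟨ fromℤ-⊖ m n ⟩
    fromℕ m - fromℕ n         ≈⟨ cancel-1 _ _ ⟨
    fromℕ (suc m) - fromℕ (suc n) ∎

  fromℤ-+ : ∀ i j → fromℤ (i ℤ.+ j) ≈ fromℤ i + fromℤ j
  fromℤ-+ (pos m)  (pos n)  = fromℕ-+ m n
  fromℤ-+ (pos m)  -[1+ n ] = fromℤ-⊖ m (suc n)
  fromℤ-+ -[1+ m ] (pos n)  = trans (fromℤ-⊖ n (suc m)) (+-comm _ _)
  fromℤ-+ -[1+ m ] -[1+ n ] = begin
    - fromℕ (suc (suc (m ℕ.+ n)))     ≡⟨ ≡.cong (λ k → - fromℕ (suc k)) (ℕ.+-suc m n) ⟨
    - fromℕ (suc m ℕ.+ suc n)         ≈⟨ -‿cong (fromℕ-+ (suc m) (suc n)) ⟩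
    - (fromℕ (suc m) + fromℕ (suc n)) ≈⟨ -‿+-comm _ _ ⟨
    - fromℕ (suc m) - fromℕ (suc n)   ∎

  fromℤ-neg : ∀ i → fromℤ (ℤ.- i) ≈ - fromℤ i
  fromℤ-neg (pos zero)    = sym -0#≈0#
  fromℤ-neg (pos (suc n)) = refl
  fromℤ-neg -[1+ n ]      = sym (-‿involutive _)

  fromℤ-*ˡ : ∀ n j → fromℤ (pos n ℤ.* j) ≈ fromℕ n * fromℤ j
  fromℤ-*ˡ zero    j = trans (reflexive (≡.cong fromℤ (ℤ.*-zeroˡ j))) (sym (zeroˡ _))
  fromℤ-*ˡ (suc n) j = begin
    fromℤ (pos (suc n) ℤ.* j)            ≡⟨ ≡.cong fromℤ (ℤ.suc-* (pos n) j) ⟩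
    fromℤ (j ℤ.+ pos n ℤ.* j)            ≈⟨ fromℤ-+ j (pos n ℤ.* j) ⟩
    fromℤ j + fromℤ (pos n ℤ.* j)        ≈⟨ +-cong (sym (*-identityˡ _)) (fromℤ-*ˡ n j) ⟩
    1# * fromℤ j + fromℕ n * fromℤ j     ≈⟨ distribʳ _ _ _ ⟨
    fromℕ (suc n) * fromℤ j              ∎

  fromℤ-* : ∀ i j → fromℤ (i ℤ.* j) ≈ fromℤ i * fromℤ j
  fromℤ-* (pos n)  j = fromℤ-*ˡ n j
  fromℤ-* -[1+ n ] j = begin
    fromℤ (-[1+ n ] ℤ.* j)               ≡⟨ ≡.cong fromℤ (ℤ.neg-distribˡ-* (pos (suc n)) j) ⟨
    fromℤ (ℤ.- (pos (suc n) ℤ.* j))      ≈⟨ fromℤ-neg (pos (suc n) ℤ.* j) ⟩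
    - fromℤ (pos (suc n) ℤ.* j)          ≈⟨ -‿cong (fromℤ-*ˡ (suc n) j) ⟩
    - (fromℕ (suc n) * fromℤ j)          ≈⟨ -‿distribˡ-* _ _ ⟩
    - fromℕ (suc n) * fromℤ j            ∎

  ℤ-morphism : ℤ.+-*-rawRing ACR.-Raw-AlmostCommutative⟶ ACR.fromCommutativeRing commutativeRing
  ℤ-morphism = record
    { ⟦_⟧    = fromℤ
    ; +-homo = fromℤ-+
    ; *-homo = fromℤ-*
    ; -‿homo = fromℤ-neg
    ; 0-homo = refl
    ; 1-homo = fromℕ-1
    }

  -- The solver has to compare coefficients, and equality in the field is not assumed decidable;
  -- with integer coefficients the comparison takes place in ℤ.
  fromℤ-weaklyDecidable : ∀ i j → Maybe (fromℤ i ≈ fromℤ j)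
  fromℤ-weaklyDecidable i j with i ℤ.≟ j
  ... | yes i≡j = just (reflexive (≡.cong fromℤ i≡j))
  ... | no _    = nothing

  module Solver = RingSolver ℤ.+-*-rawRing (ACR.fromCommutativeRing commutativeRing)
    ℤ-morphism fromℤ-weaklyDecidable

-- Inverses in the field.

module Inverses {c ℓ} (F : ValuedField c ℓ) where
  open ValuedField F renaming (zero to *-zero)
  open FieldLemmas F
  open import Relation.Binary.Reasoning.Setoid setoid
  open Solver using (solve; _:*_; _:=_)

  cancelˡ : ∀ {a x y} → ¬ a ≈ 0# → a * x ≈ a * y → x ≈ y
  cancelˡ {a} {x} {y} a≉0 ax≈ay = begin
    x              ≈⟨ undo x ⟩
    a ⁻¹ * (a * x) ≈⟨ *-congˡ ax≈ay ⟩
    a ⁻¹ * (a * y) ≈⟨ undo y ⟨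
    y              ∎
    where
    undo : ∀ z → z ≈ a ⁻¹ * (a * z)
    undo z = begin
      z              ≈⟨ *-identityˡ z ⟨
      1# * z         ≈⟨ *-congʳ (inverseʳ a a≉0) ⟨
      a * a ⁻¹ * z   ≈⟨ solve 3 (λ a b z → a :* b :* z := b :* (a :* z)) refl a (a ⁻¹) z ⟩
      a ⁻¹ * (a * z) ∎

  *-nonzero : ∀ {x y} → ¬ x ≈ 0# → ¬ y ≈ 0# → ¬ x * y ≈ 0#
  *-nonzero x≉0 y≉0 xy≈0 = y≉0 (cancelˡ x≉0 (trans xy≈0 (sym (zeroʳ _))))

  ⁻¹-nonzero : ∀ {x} → ¬ x ≈ 0# → ¬ x ⁻¹ ≈ 0#
  ⁻¹-nonzero {x} x≉0 eq = 1≉0 (trans (sym (inverseʳ x x≉0)) (trans (*-congˡ eq) (zeroʳ x)))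

  ⁻¹-unique : ∀ {x y} → x * y ≈ 1# → y ≈ x ⁻¹
  ⁻¹-unique {x} xy≈1 = cancelˡ x≉0 (trans xy≈1 (sym (inverseʳ x x≉0)))
    where
    x≉0 : ¬ x ≈ 0#
    x≉0 x≈0 = 1≉0 (trans (sym xy≈1) (trans (*-congʳ x≈0) (zeroˡ _)))

  ⁻¹-distrib-* : ∀ {x y} → ¬ x ≈ 0# → ¬ y ≈ 0# → (x * y) ⁻¹ ≈ x ⁻¹ * y ⁻¹
  ⁻¹-distrib-* {x} {y} x≉0 y≉0 = sym $ ⁻¹-unique $ begin
    x * y * (x ⁻¹ * y ⁻¹)   ≈⟨ solve 4 (λ x y a b → x :* y :* (a :* b) := x :* a :* (y :* b)) refl x y (x ⁻¹) (y ⁻¹) ⟩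
    x * x ⁻¹ * (y * y ⁻¹)   ≈⟨ *-cong (inverseʳ x x≉0) (inverseʳ y y≉0) ⟩
    1# * 1#                 ≈⟨ *-identityˡ 1# ⟩
    1#                      ∎

-- Powers of the formal logarithm. Below, `Lₖ` stands for the series with coefficients
-- `logPowCoeff k`.

module LogarithmPowers {c ℓ} (F : ValuedField c ℓ)
  (char0 : ∀ n → ¬ ValuedField._≈_ F (ValuedField.fromℕ F (suc n)) (ValuedField.0# F)) where

  open ValuedField F renaming (zero to *-zero)
  open FieldLemmas F
  open Inverses F
  open FiniteSums commutativeRing
  open import Relation.Binary.Reasoning.Setoid setoid
  open Solver using (solve; _:+_; _:*_; :-_; _:-_; _:=_; con)

  fromℕ-!-nonzero : ∀ n → ¬ fromℕ (n !) ≈ 0#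
  fromℕ-!-nonzero zero    = char0 0
  fromℕ-!-nonzero (suc n) eq =
    *-nonzero (char0 n) (fromℕ-!-nonzero n) (trans (sym (fromℕ-* (suc n) (n !))) eq)

  suc*!⁻¹ : ∀ n → fromℕ (suc n) * fromℕ (suc n !) ⁻¹ ≈ fromℕ (n !) ⁻¹
  suc*!⁻¹ n = ⁻¹-unique $ begin
    fromℕ (n !) * (fromℕ (suc n) * fromℕ (suc n !) ⁻¹)
      ≈⟨ solve 3 (λ a b c → a :* (b :* c) := b :* a :* c) refl _ _ _ ⟩
    fromℕ (suc n) * fromℕ (n !) * fromℕ (suc n !) ⁻¹
      ≈⟨ *-congʳ (fromℕ-* (suc n) (n !)) ⟨
    fromℕ (suc n !) * fromℕ (suc n !) ⁻¹
      ≈⟨ inverseʳ _ (fromℕ-!-nonzero (suc n)) ⟩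
    1# ∎

  -- The coefficients of log (1 + u) and of (log (1 + u))ᵏ / k!.
  logCoeff : ℕ → Carrier
  logCoeff zero    = 0#
  logCoeff (suc n) = (- 1#) ^ n / fromℕ (suc n)

  logPowCoeff : ℕ → ℕ → Carrier
  logPowCoeff k m = fromℤ (S₁ m k) / fromℕ (m !)

  -- The Euler operator u d/du, for which the Leibniz rule needs no index shift.
  θ : (ℕ → Carrier) → (ℕ → Carrier)
  θ f n = fromℕ n * f n

  -- The weight `n` of each term splits as `i + (n - i)`.
  θ-⋆ : ∀ f g n → θ (f ⋆ g) n ≈ (θ f ⋆ g) n + (f ⋆ θ g) n
  θ-⋆ f g n = begin
    fromℕ n * (f ⋆ g) n
      ≈⟨ ∑-*ˡ (suc n) (fromℕ n) (λ i → f i * g (n ∸ i)) ⟩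
    ∑ (suc n) (λ i → fromℕ n * (f i * g (n ∸ i)))
      ≈⟨ ∑-cong (suc n) leibniz ⟩
    ∑ (suc n) (λ i → θ f i * g (n ∸ i) + f i * θ g (n ∸ i))
      ≈⟨ ∑-+ (suc n) (λ i → θ f i * g (n ∸ i)) (λ i → f i * θ g (n ∸ i)) ⟩
    (θ f ⋆ g) n + (f ⋆ θ g) n ∎
    where
    leibniz : ∀ i → i < suc n →
      fromℕ n * (f i * g (n ∸ i)) ≈ θ f i * g (n ∸ i) + f i * θ g (n ∸ i)
    leibniz i i≤n = begin
      fromℕ n * (f i * g (n ∸ i))
        ≡⟨ ≡.cong (λ k → fromℕ k * (f i * g (n ∸ i))) (ℕ.m+[n∸m]≡n (ℕ.≤-pred i≤n)) ⟨
      fromℕ (i ℕ.+ (n ∸ i)) * (f i * g (n ∸ i))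
        ≈⟨ *-congʳ (fromℕ-+ i (n ∸ i)) ⟩
      (fromℕ i + fromℕ (n ∸ i)) * (f i * g (n ∸ i))
        ≈⟨ solve 4 (λ a b x y → (a :+ b) :* (x :* y) := a :* x :* y :+ x :* (b :* y)) refl _ _ _ _ ⟩
      θ f i * g (n ∸ i) + f i * θ g (n ∸ i) ∎

  -- `(1 + u) · θ (log (1 + u)) = u`, and multiplication by `u` shifts the index by one.
  logCoeff-θ : ∀ g n → (shift₊ (θ logCoeff) ⋆ g) (suc n) ≈ g n
  logCoeff-θ g n = begin
    0# * 0# * g (suc n) + (θ' 1 * g n + ∑ n (λ i → θ' (suc (suc i)) * g (n ∸ suc i)))
      ≈⟨ +-cong (trans (*-congʳ (zeroˡ _)) (zeroˡ _)) (+-cong (*-congʳ θ₁) (∑-zero n λ i _ → trans (*-congʳ (θ₊ i)) (zeroˡ (g (n ∸ suc i))))) ⟩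
    0# + (1# * g n + 0#)
      ≈⟨ trans (+-identityˡ _) (trans (+-identityʳ _) (*-identityˡ _)) ⟩
    g n ∎
    where
    θ' : ℕ → Carrier
    θ' = shift₊ (θ logCoeff)
    θ-suc : ∀ i → θ logCoeff (suc i) ≈ (- 1#) ^ i
    θ-suc i = begin
      fromℕ (suc i) * ((- 1#) ^ i * fromℕ (suc i) ⁻¹) ≈⟨ solve 3 (λ a b c → a :* (b :* c) := b :* (a :* c)) refl _ _ _ ⟩
      (- 1#) ^ i * (fromℕ (suc i) * fromℕ (suc i) ⁻¹) ≈⟨ *-congˡ (inverseʳ _ (char0 i)) ⟩
      (- 1#) ^ i * 1#                                 ≈⟨ *-identityʳ _ ⟩
      (- 1#) ^ i                                      ∎
    θ₁ : θ' 1 ≈ 1#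
    θ₁ = trans (+-cong (θ-suc 0) (zeroˡ _)) (+-identityʳ _)
    θ₊ : ∀ i → θ' (suc (suc i)) ≈ 0#
    θ₊ i = begin
      θ logCoeff (suc (suc i)) + θ logCoeff (suc i) ≈⟨ +-cong (θ-suc (suc i)) (θ-suc i) ⟩
      - 1# * (- 1#) ^ i + (- 1#) ^ i                ≈⟨ +-congˡ (*-identityˡ _) ⟨
      - 1# * (- 1#) ^ i + 1# * (- 1#) ^ i           ≈⟨ distribʳ _ _ _ ⟨
      (- 1# + 1#) * (- 1#) ^ i                      ≈⟨ *-congʳ (-‿inverseˡ 1#) ⟩
      0# * (- 1#) ^ i                               ≈⟨ zeroˡ _ ⟩
      0#                                            ∎

  logPowCoeff-θ-suc : ∀ k m → θ (logPowCoeff k) (suc m) ≈ fromℤ (S₁ (suc m) k) / fromℕ (m !)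
  logPowCoeff-θ-suc k m = trans
    (solve 3 (λ a b c → a :* (b :* c) := b :* (a :* c)) refl _ _ _)
    (*-congˡ (suc*!⁻¹ m))

  fromℤ-minus-* : ∀ s m → fromℤ (s ℤ.* (ℤ.- pos m)) ≈ - (fromℤ s * fromℕ m)
  fromℤ-minus-* s m = begin
    fromℤ (s ℤ.* (ℤ.- pos m))     ≈⟨ fromℤ-* s (ℤ.- pos m) ⟩
    fromℤ s * fromℤ (ℤ.- pos m)   ≈⟨ *-congˡ (fromℤ-neg (pos m)) ⟩
    fromℤ s * - fromℕ m           ≈⟨ solve 2 (λ a b → a :* (:- b) := :- (a :* b)) refl _ _ ⟩
    - (fromℤ s * fromℕ m)         ∎

  -- The case of `L₀`, which is constant, in the system of differential equations continued by
  -- `logPowCoeff-θ`.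
  logPowCoeff-θ-zero : ∀ m → shift₊ (θ (logPowCoeff 0)) (suc m) ≈ 0#
  logPowCoeff-θ-zero m = begin
    θ (logPowCoeff 0) (suc m) + θ (logPowCoeff 0) m
      ≈⟨ +-congʳ (trans (logPowCoeff-θ-suc 0 m) (*-congʳ (trans (reflexive (≡.cong fromℤ (S₁-suc-zero m))) (fromℤ-minus-* (S₁ m 0) m)))) ⟩
    - (fromℤ (S₁ m 0) * fromℕ m) * fromℕ (m !) ⁻¹ + fromℕ m * (fromℤ (S₁ m 0) * fromℕ (m !) ⁻¹)
      ≈⟨ solve 3 (λ s n i → :- (s :* n) :* i :+ n :* (s :* i) := con (pos 0)) refl _ _ _ ⟩
    0# ∎

  -- The differential equation `(1 + u) · Lₖ₊₁′ = Lₖ`. It comes from the recurrence of the Stirling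
  -- numbers alone, before `Lₖ` is known to be a power of the logarithm.
  logPowCoeff-θ : ∀ k m → shift₊ (θ (logPowCoeff (suc k))) (suc m) ≈ logPowCoeff k m
  logPowCoeff-θ k m = begin
    θ (logPowCoeff (suc k)) (suc m) + θ (logPowCoeff (suc k)) m
      ≈⟨ +-congʳ (trans (logPowCoeff-θ-suc (suc k) m) (*-congʳ S₁-rec)) ⟩
    (fromℤ (S₁ m k) - fromℤ (S₁ m (suc k)) * fromℕ m) * fromℕ (m !) ⁻¹
      + fromℕ m * (fromℤ (S₁ m (suc k)) * fromℕ (m !) ⁻¹)
      ≈⟨ solve 4 (λ r s n i → (r :- s :* n) :* i :+ n :* (s :* i) := r :* i) refl _ _ _ _ ⟩
    logPowCoeff k m ∎
    where
    S₁-rec : fromℤ (S₁ (suc m) (suc k)) ≈ fromℤ (S₁ m k) - fromℤ (S₁ m (suc k)) * fromℕ m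
    S₁-rec = begin
      fromℤ (S₁ (suc m) (suc k))                                   ≡⟨ ≡.cong fromℤ (S₁-suc-suc m k) ⟩
      fromℤ (S₁ m k ℤ.+ S₁ m (suc k) ℤ.* (ℤ.- pos m))             ≈⟨ fromℤ-+ (S₁ m k) (S₁ m (suc k) ℤ.* (ℤ.- pos m)) ⟩
      fromℤ (S₁ m k) + fromℤ (S₁ m (suc k) ℤ.* (ℤ.- pos m))       ≈⟨ +-congˡ (fromℤ-minus-* (S₁ m (suc k)) m) ⟩
      fromℤ (S₁ m k) - fromℤ (S₁ m (suc k)) * fromℕ m             ∎

  -- Both sides have the same image under `(1 + u) · θ`, and that image determines a series with
  -- given constant term: in degree `n + 1` it involves only the coefficients in degrees `n` and
  -- `n + 1`, the latter with the factor `n + 1`, which is cancelled in characteristic zero. The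
  -- induction is on `k` and, inside, on `n`.
  log-⋆-logPow : ∀ k n → (logCoeff ⋆ logPowCoeff k) n ≈ fromℕ (suc k) * logPowCoeff (suc k) n
  -- For positive `k`, `(1 + u) · θ Lₖ = u · Lₖ₋₁`, so this summand of the Leibniz rule is a product
  -- with the logarithm of lower order, known by induction on `k`.
  log-⋆-θlogPow : ∀ k n →
    (logCoeff ⋆ shift₊ (θ (logPowCoeff k))) (suc n) ≈ fromℕ k * logPowCoeff k n

  log-⋆-θlogPow zero n = begin
    (logCoeff ⋆ shift₊ (θ (logPowCoeff 0))) (suc n)
      ≈⟨ ⋆-cong {logCoeff} {logCoeff} (λ _ → refl) θE≈0 (suc n) ⟩
    (logCoeff ⋆ (λ _ → 0#)) (suc n)
      ≈⟨ ∑-zero (suc (suc n)) (λ i _ → zeroʳ (logCoeff i)) ⟩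
    0#
      ≈⟨ zeroˡ _ ⟨
    0# * logPowCoeff 0 n ∎
    where
    θE≈0 : ∀ m → shift₊ (θ (logPowCoeff 0)) m ≈ 0#
    θE≈0 zero    = zeroˡ _
    θE≈0 (suc m) = logPowCoeff-θ-zero m
  log-⋆-θlogPow (suc k) n = begin
    (logCoeff ⋆ shift₊ (θ (logPowCoeff (suc k)))) (suc n)
      ≈⟨ ⋆-suc logCoeff (shift₊ (θ (logPowCoeff (suc k)))) n ⟩
    ∑ (suc n) (λ i → logCoeff i * shift₊ (θ (logPowCoeff (suc k))) (suc (n ∸ i)))
      + logCoeff (suc n) * (0# * logPowCoeff (suc k) 0)
      ≈⟨ +-cong (∑-cong (suc n) (λ i _ → *-congˡ {logCoeff i} (logPowCoeff-θ k (n ∸ i)))) (trans (*-congˡ (zeroˡ _)) (zeroʳ _)) ⟩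
    (logCoeff ⋆ logPowCoeff k) n + 0#
      ≈⟨ +-identityʳ _ ⟩
    (logCoeff ⋆ logPowCoeff k) n
      ≈⟨ log-⋆-logPow k n ⟩
    fromℕ (suc k) * logPowCoeff (suc k) n ∎

  log-⋆-logPow k zero = begin
    0# * logPowCoeff k 0 + 0#
      ≈⟨ trans (+-identityʳ _) (zeroˡ _) ⟩
    0#
      ≈⟨ solve 2 (λ a b → a :* (con (pos 0) :* b) := con (pos 0)) refl (fromℕ (suc k)) (fromℕ 1 ⁻¹) ⟨
    fromℕ (suc k) * (0# * fromℕ 1 ⁻¹) ∎
  log-⋆-logPow k (suc n) = cancelˡ (char0 n) $ begin
    θ A (suc n)
      ≈⟨ solve 2 (λ a b → a := a :+ b :- b) refl _ (θ A n) ⟩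
    θ A (suc n) + θ A n - θ A n
      ≈⟨ +-cong step (-‿cong (*-congˡ (log-⋆-logPow k n))) ⟩
    E k n + fromℕ k * E k n - fromℕ n * (fromℕ (suc k) * E (suc k) n)
      ≈⟨ +-congʳ (trans (+-congʳ (sym (*-identityˡ _))) (sym (distribʳ _ _ _))) ⟩
    fromℕ (suc k) * E k n - fromℕ n * (fromℕ (suc k) * E (suc k) n)
      ≈⟨ +-congʳ (*-congˡ (logPowCoeff-θ k n)) ⟨
    fromℕ (suc k) * (fromℕ (suc n) * E (suc k) (suc n) + fromℕ n * E (suc k) n) - fromℕ n * (fromℕ (suc k) * E (suc k) n)
      ≈⟨ solve 5 (λ k n′ x n y → k :* (n′ :* x :+ n :* y) :- n :* (k :* y) := n′ :* (k :* x)) refl (fromℕ (suc k)) (fromℕ (suc n)) _ _ _ ⟩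
    fromℕ (suc n) * (fromℕ (suc k) * E (suc k) (suc n)) ∎
    where
    E : ℕ → ℕ → Carrier
    E = logPowCoeff
    A : ℕ → Carrier
    A = logCoeff ⋆ E k
    step : θ A (suc n) + θ A n ≈ E k n + fromℕ k * E k n
    step = begin
      θ A (suc n) + θ A n
        ≈⟨ +-cong (θ-⋆ logCoeff (E k) (suc n)) (θ-⋆ logCoeff (E k) n) ⟩
      (θ logCoeff ⋆ E k) (suc n) + (logCoeff ⋆ θ (E k)) (suc n) + ((θ logCoeff ⋆ E k) n + (logCoeff ⋆ θ (E k)) n)
        ≈⟨ solve 4 (λ a b c d → a :+ b :+ (c :+ d) := (a :+ c) :+ (b :+ d)) refl _ _ _ _ ⟩
      ((θ logCoeff ⋆ E k) (suc n) + (θ logCoeff ⋆ E k) n) + ((logCoeff ⋆ θ (E k)) (suc n) + (logCoeff ⋆ θ (E k)) n)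
        ≈⟨ +-cong (shift₊-⋆ˡ (θ logCoeff) (E k) n) (shift₊-⋆ʳ logCoeff (θ (E k)) n) ⟨
      (shift₊ (θ logCoeff) ⋆ E k) (suc n) + (logCoeff ⋆ shift₊ (θ (E k))) (suc n)
        ≈⟨ +-cong (logCoeff-θ (E k) n) (log-⋆-θlogPow k n) ⟩
      E k n + fromℕ k * E k n ∎

-- Multiples of rationals and the archimedean property.

open Algebra.Properties.CommutativeMonoid.Mult ℚ.+-0-commutativeMonoid
  renaming (_×_ to _·_) using (×-homo-+; ×-distrib-+)

·-monoʳ-≤ : ∀ n {r s} → r ℚ.≤ s → n · r ℚ.≤ n · s
·-monoʳ-≤ zero    r≤s = ℚ.≤-refl
·-monoʳ-≤ (suc n) r≤s = ℚ.+-mono-≤ r≤s (·-monoʳ-≤ n r≤s)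

·-zeroʳ : ∀ n → n · 0ℚ ≡ 0ℚ
·-zeroʳ zero    = ≡.refl
·-zeroʳ (suc n) = ≡.trans (ℚ.+-identityˡ (n · 0ℚ)) (·-zeroʳ n)

·-nonneg : ∀ n {r} → 0ℚ ℚ.≤ r → 0ℚ ℚ.≤ n · r
·-nonneg n {r} 0≤r = ≡.subst (ℚ._≤ n · r) (·-zeroʳ n) (·-monoʳ-≤ n 0≤r)

≤+nonneg : ∀ {r s} → 0ℚ ℚ.≤ s → r ℚ.≤ r ℚ.+ s
≤+nonneg {r} {s} 0≤s = ≡.subst (ℚ._≤ r ℚ.+ s) (ℚ.+-identityʳ r) (ℚ.+-monoʳ-≤ r 0≤s)

·-monoˡ-≤ : ∀ {m n} {r} → 0ℚ ℚ.≤ r → m ≤ n → m · r ℚ.≤ n · r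
·-monoˡ-≤ {m} {n} {r} 0≤r m≤n = ≡.subst (m · r ℚ.≤_)
  (≡.trans (≡.sym (×-homo-+ r m (n ∸ m))) (≡.cong (_· r) (ℕ.m+[n∸m]≡n m≤n)))
  (≤+nonneg (·-nonneg (n ∸ m) 0≤r))

n·1≃n : ∀ n → ℚ.toℚᵘ (n · 1ℚ) ℚᵘ.≃ ℚᵘ.mkℚᵘ (pos n) 0
n·1≃n zero    = ℚᵘ.≃-refl
n·1≃n (suc n) = ℚᵘ.≃-trans (ℚ.toℚᵘ-homo-+ 1ℚ (n · 1ℚ))
  (ℚᵘ.≃-trans (ℚᵘ.+-congʳ (ℚ.toℚᵘ 1ℚ) (n·1≃n n))
              (ℚᵘ.*≡* (≡.cong (λ i → (pos 1 ℤ.+ i) ℤ.* pos 1) (ℤ.*-identityʳ (pos n)))))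

archimedean : ∀ r → ∃[ n ] r ℚ.≤ n · 1ℚ
-- The denominator is at least 1, so the absolute value of the numerator is already large enough.
archimedean r@(mkℚ i d _) = ℤ.∣ i ∣ , ℚ.toℚᵘ-cancel-≤
  (ℚᵘ.≤-respʳ-≃ (ℚᵘ.≃-sym (n·1≃n ℤ.∣ i ∣)) (ℚᵘ.*≤* (bound i)))
  where
  bound : ∀ i → i ℤ.* pos 1 ℤ.≤ pos ℤ.∣ i ∣ ℤ.* pos (suc d)
  bound (pos n)  = ≡.subst₂ ℤ._≤_ (≡.sym (ℤ.*-identityʳ (pos n))) (ℤ.pos-* n (suc d)) (+≤+ (ℕ.m≤m*n n (suc d)))
  bound -[1+ n ] = -≤+

0≤1ℚ : 0ℚ ℚ.≤ 1ℚ
0≤1ℚ = ℚ.*≤* (+≤+ z≤n)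

-- Bounds on valuations, null sequences and convergent series.

module Valuation {c ℓ} (F : ValuedField c ℓ) where
  open ValuedField F renaming (zero to *-zero)
  open FieldLemmas F
  open Inverses F
  open FiniteSums commutativeRing
  open Algebra.Properties.Ring ring using (-1*x≈-x)
  open import Relation.Binary.Reasoning.Setoid setoid
  open Solver using (solve; _:+_; _:*_; :-_; _:-_; _:=_)

  infix 4 _⊒_

  -- That is, `|x| ≤ p^(-r)`. Such bounds also cover `x ≈ 0#`, whose valuation is `⊤⁺`, so estimates
  -- need no case distinction.
  _⊒_ : Carrier → ℚ → Set
  x ⊒ r = [ r ] ≤⁺ v x

  ⊒-cong : ∀ {x y r} → x ≈ y → x ⊒ r → y ⊒ r
  ⊒-cong x≈y = ≡.subst (_ ≤⁺_) (v-cong x≈y)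

  ⊒-weaken : ∀ {x r s} → s ℚ.≤ r → x ⊒ r → x ⊒ s
  ⊒-weaken s≤r = ≤⁺-trans ℚ.≤-trans [ s≤r ]

  v≡⇒⊒ : ∀ {x r} → v x ≡ [ r ] → x ⊒ r
  v≡⇒⊒ vx≡r = ≡.subst (_ ≤⁺_) (≡.sym vx≡r) [ ℚ.≤-refl ]

  ⊒⇒≤ : ∀ {x r s} → v x ≡ [ s ] → x ⊒ r → r ℚ.≤ s
  ⊒⇒≤ vx≡s x⊒r = [≤]-injective (≡.subst (_ ≤⁺_) vx≡s x⊒r)

  ≈0⇒⊒ : ∀ {x r} → x ≈ 0# → x ⊒ r
  ≈0⇒⊒ {x} x≈0 = ≡.subst (_ ≤⁺_) (≡.sym (Equivalence.from (v-⊤ x) x≈0)) (_ ≤⊤⁺)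

  v-finite : ∀ {x} → ¬ x ≈ 0# → ∃[ r ] v x ≡ [ r ]
  v-finite {x} x≉0 with v x in eq
  ... | [ r ] = r , ≡.refl
  ... | ⊤⁺    = contradiction (Equivalence.to (v-⊤ x) eq) x≉0

  finite⇒≉0 : ∀ {x r} → v x ≡ [ r ] → ¬ x ≈ 0#
  finite⇒≉0 {x} vx≡r x≈0 with ≡.trans (≡.sym vx≡r) (Equivalence.from (v-⊤ x) x≈0)
  ... | ()

  bounded : ∀ x → ∃[ r ] x ⊒ r
  bounded x with v x
  ... | [ r ] = r , [ ℚ.≤-refl ]
  ... | ⊤⁺    = 0ℚ , (_ ≤⊤⁺)

  +-⊒ : ∀ {x y r} → x ⊒ r → y ⊒ r → x + y ⊒ r
  +-⊒ = v-+ _ _ _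

  *-⊒ : ∀ {x y r s} → x ⊒ r → y ⊒ s → x * y ⊒ r ℚ.+ s
  *-⊒ {x} {y} x⊒r y⊒s = ≡.subst (_ ≤⁺_) (≡.sym (v-* x y)) (add x⊒r y⊒s)
    where
    add : ∀ {a b r s} → [ r ] ≤⁺ a → [ s ] ≤⁺ b → [ r ℚ.+ s ] ≤⁺ a +⁺ b
    add [ r≤a ]   [ s≤b ]   = [ ℚ.+-mono-≤ r≤a s≤b ]
    add [ r≤a ]   (_ ≤⊤⁺)   = _ ≤⊤⁺
    add (_ ≤⊤⁺)   _         = _ ≤⊤⁺

  ⊒-resp : ∀ {x r s} → r ≡ s → x ⊒ r → x ⊒ s
  ⊒-resp {x} = ≡.subst (x ⊒_)

  *-⊒-integral : ∀ {x y s} → x ⊒ 0ℚ → y ⊒ s → x * y ⊒ s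
  *-⊒-integral x⊒0 y⊒s = ⊒-resp (ℚ.+-identityˡ _) (*-⊒ x⊒0 y⊒s)

  v-*-finite : ∀ {x y r s} → v x ≡ [ r ] → v y ≡ [ s ] → v (x * y) ≡ [ r ℚ.+ s ]
  v-*-finite {x} {y} vx vy = ≡.trans (v-* x y) (≡.cong₂ _+⁺_ vx vy)

  v-1 : v 1# ≡ [ 0ℚ ]
  v-1 with r , v1≡r ← v-finite 1≉0 = ≡.trans v1≡r (≡.cong [_] r≡0)
    where
    r+r≡r : r ℚ.+ r ≡ r
    r+r≡r = []-injective (≡.trans (≡.sym (v-*-finite v1≡r v1≡r)) (≡.trans (v-cong (*-identityˡ 1#)) v1≡r))
    r≡0 : r ≡ 0ℚ
    r≡0 = ≡.trans (≡.sym (ℚ.+-identityʳ r)) (≡.trans (≡.cong (r ℚ.+_) (≡.sym (ℚ.+-inverseʳ r)))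
      (≡.trans (≡.sym (ℚ.+-assoc r r (ℚ.- r))) (≡.trans (≡.cong (ℚ._- r) r+r≡r) (ℚ.+-inverseʳ r))))

  1-⊒ : 1# ⊒ 0ℚ
  1-⊒ = v≡⇒⊒ v-1

  -1≉0 : ¬ - 1# ≈ 0#
  -1≉0 eq = 1≉0 (trans (sym (+-identityˡ 1#)) (trans (+-congʳ (sym eq)) (-‿inverseˡ 1#)))

  -- Twice the valuation of `- 1#` is that of `1#`, which is 0, so it cannot be negative.
  -1-⊒ : - 1# ⊒ 0ℚ
  -1-⊒ with r , v≡r ← v-finite -1≉0 with 0ℚ ℚ.≤? r
  ... | yes 0≤r = ≡.subst (_ ≤⁺_) (≡.sym v≡r) [ 0≤r ]
  ... | no  0≰r = contradiction (ℚ.+-mono-< (ℚ.≰⇒> 0≰r) (ℚ.≰⇒> 0≰r)) (ℚ.<-irrefl r+r≡0)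
    where
    r+r≡0 : r ℚ.+ r ≡ 0ℚ
    r+r≡0 = []-injective (≡.trans (≡.sym (v-*-finite v≡r v≡r)) (≡.trans
      (v-cong (trans (-1*x≈-x (- 1#)) (solve 1 (λ x → :- (:- x) := x) refl 1#))) v-1))

  neg-⊒ : ∀ {x r} → x ⊒ r → - x ⊒ r
  neg-⊒ {x} {r} x⊒r = ⊒-cong (-1*x≈-x x) (*-⊒-integral -1-⊒ x⊒r)

  sub-⊒ : ∀ {x y r} → x ⊒ r → y ⊒ r → x - y ⊒ r
  sub-⊒ x⊒r y⊒r = +-⊒ x⊒r (neg-⊒ y⊒r)

  fromℕ-⊒ : ∀ n → fromℕ n ⊒ 0ℚ
  fromℕ-⊒ zero    = ≈0⇒⊒ refl
  fromℕ-⊒ (suc n) = +-⊒ 1-⊒ (fromℕ-⊒ n)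

  fromℤ-⊒ : ∀ i → fromℤ i ⊒ 0ℚ
  fromℤ-⊒ (pos n)  = fromℕ-⊒ n
  fromℤ-⊒ -[1+ n ] = neg-⊒ (fromℕ-⊒ (suc n))

  ^-⊒ : ∀ {x r} n → x ⊒ r → x ^ n ⊒ n · r
  ^-⊒ zero    x⊒r = 1-⊒
  ^-⊒ (suc n) x⊒r = *-⊒ x⊒r (^-⊒ n x⊒r)

  v-^ : ∀ {x r} n → v x ≡ [ r ] → v (x ^ n) ≡ [ n · r ]
  v-^ zero    vx = v-1
  v-^ (suc n) vx = v-*-finite vx (v-^ n vx)

  ∑-⊒ : ∀ N {a r} → (∀ i → i < N → a i ⊒ r) → ∑ N a ⊒ r
  ∑-⊒ zero    h = ≈0⇒⊒ refl
  ∑-⊒ (suc N) h = +-⊒ (h 0 (s≤s z≤n)) (∑-⊒ N (λ i i<N → h (suc i) (s≤s i<N)))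

  v-⁻¹ : ∀ {x r} → v x ≡ [ r ] → v (x ⁻¹) ≡ [ ℚ.- r ]
  v-⁻¹ {x} {r} vx≡r with s , v≡s ← v-finite (⁻¹-nonzero (finite⇒≉0 vx≡r)) = ≡.trans v≡s (≡.cong [_] s≡-r)
    where
    r+s≡0 : r ℚ.+ s ≡ 0ℚ
    r+s≡0 = []-injective (≡.trans (≡.sym (v-*-finite vx≡r v≡s)) (≡.trans (v-cong (inverseʳ x (finite⇒≉0 vx≡r))) v-1))
    s≡-r : s ≡ ℚ.- r
    s≡-r = ≡.trans (≡.sym (ℚ.+-identityˡ s)) (≡.trans (≡.cong (ℚ._+ s) (≡.sym (ℚ.+-inverseˡ r)))
      (≡.trans (ℚ.+-assoc (ℚ.- r) r s) (≡.trans (≡.cong (ℚ.- r ℚ.+_) r+s≡0) (ℚ.+-identityʳ (ℚ.- r)))))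

  ⊒-all⇒≈0 : ∀ {x} → (∀ r → x ⊒ r) → x ≈ 0#
  ⊒-all⇒≈0 {x} h with v x in eq
  ... | ⊤⁺    = Equivalence.to (v-⊤ x) eq
  ... | [ s ] = contradiction (ℚ.<-≤-trans s<s+1 ([≤]-injective (h (s ℚ.+ 1ℚ)))) (ℚ.<-irrefl ≡.refl)
    where
    s<s+1 : s ℚ.< s ℚ.+ 1ℚ
    s<s+1 = ≡.subst (ℚ._< s ℚ.+ 1ℚ) (ℚ.+-identityʳ s) (ℚ.+-monoʳ-< s (ℚ.*<* (+<+ (s≤s z≤n))))

  -- `ConvergesTo s x` unfolds to `Null` of `s n - x`; the closure properties of null sequences
  -- therefore apply to `HasSum` without conversion.
  Null : (ℕ → Carrier) → Set
  Null a = ∀ r → ∃[ N ] (∀ n → n ≥ N → a n ⊒ r)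

  Null-+ : ∀ {a b} → Null a → Null b → Null (λ n → a n + b n)
  Null-+ a→0 b→0 r with M , hM ← a→0 r | N , hN ← b→0 r =
    M ℕ.+ N , λ n n≥ → +-⊒ (hM n (ℕ.≤-trans (ℕ.m≤m+n M N) n≥)) (hN n (ℕ.≤-trans (ℕ.m≤n+m N M) n≥))

  Null-cong : ∀ {a b} → (∀ n → a n ≈ b n) → Null a → Null b
  Null-cong a≈b a→0 r with N , h ← a→0 r = N , λ n n≥N → ⊒-cong (a≈b n) (h n n≥N)

  r-s+s : ∀ r s → (r ℚ.- s) ℚ.+ s ≡ r
  r-s+s r s = ≡.trans (ℚ.+-assoc r (ℚ.- s) s) (≡.trans (≡.cong (r ℚ.+_) (ℚ.+-inverseˡ s)) (ℚ.+-identityʳ r))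

  *-⊒-cancel : ∀ {x y r s} → x ⊒ r ℚ.- s → y ⊒ s → x * y ⊒ r
  *-⊒-cancel {r = r} {s} x⊒ y⊒ = ⊒-resp (r-s+s r s) (*-⊒ x⊒ y⊒)

  Null-* : ∀ {a} c → Null a → Null (λ n → a n * c)
  Null-* c a→0 r with B , c⊒B ← bounded c with N , h ← a→0 (r ℚ.- B) =
    N , λ n n≥N → *-⊒-cancel {r = r} {B} (h n n≥N) c⊒B

  Null-suc : ∀ {a} → Null a → Null (a ∘ suc)
  Null-suc a→0 r with N , h ← a→0 r = N , λ n n≥N → h (suc n) (ℕ.m≤n⇒m≤1+n n≥N)

  prefix-bounded : ∀ (a : ℕ → Carrier) N → ∃[ B ] (∀ n → n < N → a n ⊒ B)
  prefix-bounded a zero    = 0ℚ , λ _ ()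
  prefix-bounded a (suc N) with B , g ← prefix-bounded a N | C , aN⊒C ← bounded (a N) = B ℚ.⊓ C , ext
    where
    ext : ∀ n → n < suc N → a n ⊒ B ℚ.⊓ C
    ext n n≤N with ℕ.m≤n⇒m<n∨m≡n (ℕ.≤-pred n≤N)
    ... | inj₁ n<N    = ⊒-weaken (ℚ.p⊓q≤p B C) (g n n<N)
    ... | inj₂ ≡.refl = ⊒-weaken (ℚ.p⊓q≤q B C) aN⊒C

  Null-bounded : ∀ {a} → Null a → ∃[ B ] (∀ n → a n ⊒ B)
  Null-bounded {a} a→0 with N , h ← a→0 0ℚ with B , g ← prefix-bounded a N =
    B ℚ.⊓ 0ℚ , all
    where
    all : ∀ n → a n ⊒ B ℚ.⊓ 0ℚ
    all n with n ℕ.<? N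
    ... | yes n<N = ⊒-weaken (ℚ.p⊓q≤p B 0ℚ) (g n n<N)
    ... | no  n≮N = ⊒-weaken (ℚ.p⊓q≤q B 0ℚ) (h n (ℕ.≮⇒≥ n≮N))

  -- For `n ≥ M + N`, either `i ≥ M` or `n - i ≥ N`, so in every term one factor is small and the
  -- other bounded. By the ultrametric inequality the sum is as small as its terms.
  Null-⋆ : ∀ {f g} → Null f → Null g → Null (f ⋆ g)
  Null-⋆ {f} {g} f→0 g→0 r
    with A , fA ← Null-bounded f→0 | B , gB ← Null-bounded g→0
    with M , hM ← f→0 (r ℚ.- B) | N , hN ← g→0 (r ℚ.- A) =
    M ℕ.+ N , λ n n≥M+N → ∑-⊒ (suc n) (λ i _ → term n n≥M+N i)
    where
    term : ∀ n → n ≥ M ℕ.+ N → ∀ i → f i * g (n ∸ i) ⊒ r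
    term n n≥M+N i with M ℕ.≤? i
    ... | yes M≤i = *-⊒-cancel {r = r} {B} (hM i M≤i) (gB (n ∸ i))
    ... | no  M≰i = ⊒-cong (*-comm _ _) (*-⊒-cancel {r = r} {A} (hN (n ∸ i) N≤n∸i) (fA i))
      where
      N≤n∸i : N ≤ n ∸ i
      N≤n∸i = ℕ.m+n≤o⇒m≤o∸n N (ℕ.≤-trans (ℕ.+-monoʳ-≤ N (ℕ.<⇒≤ (ℕ.≰⇒> M≰i)))
                (ℕ.≤-trans (ℕ.≤-reflexive (ℕ.+-comm N M)) n≥M+N))

  HasSum-cong : ∀ {a b s t} → (∀ n → a n ≈ b n) → s ≈ t → HasSum a s → HasSum b t
  HasSum-cong a≈b s≈t = Null-cong (λ N → +-cong (∑-cong N (λ i _ → a≈b i)) (-‿cong s≈t))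

  HasSum-sub : ∀ {a b s t} → HasSum a s → HasSum b t → HasSum (λ n → a n - b n) (s - t)
  HasSum-sub {a} {b} {s} {t} a→s b→t = Null-cong
    (λ N → begin
      (∑ N a - s) + (∑ N b - t) * - 1#         ≈⟨ solve 5 (λ a s b t e → (a :- s) :+ (b :- t) :* e := a :+ b :* e :- (s :+ t :* e)) refl _ _ _ _ _ ⟩
      ∑ N a + ∑ N b * - 1# - (s + t * - 1#)    ≈⟨ +-cong (partial N) (-‿cong (+-congˡ (*-1 t))) ⟩
      ∑ N (λ n → a n - b n) - (s - t)          ∎)
    (Null-+ a→s (Null-* (- 1#) b→t))
    where
    *-1 : ∀ x → x * - 1# ≈ - x
    *-1 x = trans (*-comm _ _) (-1*x≈-x x)
    partial : ∀ N → ∑ N a + ∑ N b * - 1# ≈ ∑ N (λ n → a n - b n)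
    partial N = begin
      ∑ N a + ∑ N b * - 1#             ≈⟨ +-congˡ (∑-*ʳ N (- 1#) b) ⟩
      ∑ N a + ∑ N (λ n → b n * - 1#)   ≈⟨ ∑-+ N a (λ n → b n * - 1#) ⟨
      ∑ N (λ n → a n + b n * - 1#)     ≈⟨ ∑-cong N (λ n _ → +-congˡ {a n} (*-1 (b n))) ⟩
      ∑ N (λ n → a n - b n)            ∎

  HasSum-* : ∀ {a s} c → HasSum a s → HasSum (λ n → a n * c) (s * c)
  HasSum-* {a} {s} c a→s = Null-cong
    (λ N → begin
      (∑ N a - s) * c                  ≈⟨ solve 3 (λ a s c → (a :- s) :* c := a :* c :- s :* c) refl _ _ _ ⟩
      ∑ N a * c - s * c                ≈⟨ +-congʳ (∑-*ʳ N c a) ⟩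
      ∑ N (λ n → a n * c) - s * c      ∎)
    (Null-* c a→s)

  HasSum-tail : ∀ {a s} → HasSum a s → HasSum (a ∘ suc) (s - a 0)
  HasSum-tail {a} {s} a→s = Null-cong
    (λ N → solve 3 (λ x y s → x :+ y :- s := y :- (s :- x)) refl _ _ _) (Null-suc a→s)

  -- Every partial sum satisfies the bound, and one of them differs from `s` by an element that
  -- satisfies it too.
  HasSum-⊒ : ∀ {a s r} → (∀ n → a n ⊒ r) → HasSum a s → s ⊒ r
  HasSum-⊒ {a} {s} {r} a⊒r a→s with N , h ← a→s r = ⊒-cong
    (solve 2 (λ x s → x :- (x :- s) := s) refl (∑ N a) s)
    (sub-⊒ (∑-⊒ N (λ i _ → a⊒r i)) (h N ℕ.≤-refl))

  HasSum⇒Null : ∀ {a s} → HasSum a s → Null a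
  HasSum⇒Null {a} {s} a→s r with N , h ← a→s r = N , λ n n≥N → ⊒-cong
    (begin
      ∑ (suc n) a - s - (∑ n a - s)    ≈⟨ +-congʳ (+-congʳ (∑-snoc n a)) ⟩
      ∑ n a + a n - s - (∑ n a - s)    ≈⟨ solve 3 (λ x y s → x :+ y :- s :- (x :- s) := y) refl _ _ _ ⟩
      a n                              ∎)
    (sub-⊒ (h (suc n) (ℕ.m≤n⇒m≤1+n n≥N)) (h n n≥N))

  HasSum-0 : HasSum (λ _ → 0#) 0#
  HasSum-0 r = 0 , λ N _ → ≈0⇒⊒ (trans (+-congʳ (∑-zero N (λ _ _ → refl))) (-‿inverseʳ 0#))

  HasSum-+ : ∀ {a b s t} → HasSum a s → HasSum b t → HasSum (λ n → a n + b n) (s + t)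
  HasSum-+ {a} {b} {s} {t} a→s b→t = Null-cong
    (λ N → trans (solve 4 (λ a s b t → (a :- s) :+ (b :- t) := a :+ b :- (s :+ t)) refl _ _ _ _)
                 (+-congʳ (sym (∑-+ N a b))))
    (Null-+ a→s b→t)

  HasSum-∑ : ∀ K {a : ℕ → ℕ → Carrier} {s} → (∀ k → HasSum (a k) (s k)) →
             HasSum (λ n → ∑ K (λ k → a k n)) (∑ K s)
  HasSum-∑ zero    h = HasSum-0
  HasSum-∑ (suc K) {a} h = HasSum-+ {a 0} {λ n → ∑ K (λ k → a (suc k) n)} (h 0) (HasSum-∑ K {a ∘ suc} (h ∘ suc))

  -- With `A`, `B` the partial sums, the error at `N` is the Cauchy product of `a` with `B - t`,
  -- both null, plus `(A (N + 1) - s) * t`. The index `N + 1` appears because the Cauchy product at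
  -- `N` has `N + 1` terms.
  HasSum-⋆ : ∀ {a b s t} → HasSum a s → HasSum b t → HasSum (a ⋆ b) (s * t)
  HasSum-⋆ {a} {b} {s} {t} a→s b→t = Null-cong split
    (Null-+ (Null-⋆ (HasSum⇒Null {a} a→s) b→t) (Null-* t (Null-suc {λ N → ∑ N a - s} a→s)))
    where
    split : ∀ N → (a ⋆ (λ k → ∑ k b - t)) N + (∑ (suc N) a - s) * t ≈ ∑ N (a ⋆ b) - s * t
    split N = begin
      (a ⋆ (λ k → ∑ k b - t)) N + (∑ (suc N) a - s) * t
        ≈⟨ solve 4 (λ x y s t → x :+ (y :- s) :* t := x :+ y :* t :- s :* t) refl _ _ _ _ ⟩
      (a ⋆ (λ k → ∑ k b - t)) N + ∑ (suc N) a * t - s * t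
        ≈⟨ +-congʳ (+-congˡ (∑-*ʳ (suc N) t a)) ⟩
      (a ⋆ (λ k → ∑ k b - t)) N + ∑ (suc N) (λ i → a i * t) - s * t
        ≈⟨ +-congʳ (∑-+ (suc N) (λ i → a i * (∑ (N ∸ i) b - t)) (λ i → a i * t)) ⟨
      ∑ (suc N) (λ i → a i * (∑ (N ∸ i) b - t) + a i * t) - s * t
        ≈⟨ +-congʳ (∑-cong (suc N) (λ i _ → solve 3 (λ a b t → a :* (b :- t) :+ a :* t := a :* b) refl (a i) (∑ (N ∸ i) b) t)) ⟩
      (a ⋆ (λ k → ∑ k b)) N - s * t
        ≈⟨ +-congʳ (∑-⋆ a b N) ⟨
      ∑ N (a ⋆ b) - s * t ∎

-- The p-adic valuation of factorials.

·-neg : ∀ n r → n · (ℚ.- r) ≡ ℚ.- (n · r)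
·-neg zero    r = ≡.refl
·-neg (suc n) r = ≡.trans (≡.cong (ℚ.- r ℚ.+_) (·-neg n r)) (≡.sym (ℚ.neg-distrib-+ r (n · r)))

0<1ℚ : 0ℚ ℚ.< 1ℚ
0<1ℚ = ℚ.*<* (+<+ (s≤s z≤n))

[0]+⁺ : ∀ a → [ 0ℚ ] +⁺ a ≡ a
[0]+⁺ [ r ] = ≡.cong [_] (ℚ.+-identityˡ r)
[0]+⁺ ⊤⁺    = ≡.refl

·-antimonoˡ-≤ : ∀ {m n r} → r ℚ.≤ 0ℚ → m ≤ n → n · r ℚ.≤ m · r
·-antimonoˡ-≤ {m} {n} {r} r≤0 m≤n = ≡.subst₂ ℚ._≤_
  (≡.trans (≡.sym (×-homo-+ r m (n ∸ m))) (≡.cong (_· r) (ℕ.m+[n∸m]≡n m≤n)))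
  (≡.trans (≡.cong (m · r ℚ.+_) (·-zeroʳ (n ∸ m))) (ℚ.+-identityʳ (m · r)))
  (ℚ.+-monoʳ-≤ (m · r) (·-monoʳ-≤ (n ∸ m) r≤0))

module FactorialValuation {c ℓ} {p : ℕ} (p-prime : Prime p) (ℂₚ : PAdicComplexNumbers p c ℓ) where
  open PAdicComplexNumbers ℂₚ renaming (zero to *-zero)
  open FieldLemmas valuedField
  open Inverses valuedField
  open Valuation valuedField
  open import Relation.Binary.Reasoning.Setoid setoid
  open Solver using (solve; _:+_; _:*_; :-_; _:-_; _:=_)

  private instance
    p≢0 : ℕ.NonZero p
    p≢0 = prime⇒nonZero p-prime
    p>1 : ℕ.NonTrivial p
    p>1 = prime⇒nonTrivial p-prime

  1-⋣ : ∀ {s} → 0ℚ ℚ.< s → ¬ 1# ⊒ s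
  1-⋣ 0<s 1⊒s = ℚ.<-irrefl ≡.refl (ℚ.<-≤-trans 0<s (⊒⇒≤ v-1 1⊒s))

  fromℕ-*-⊒ : ∀ {y s} x → fromℕ y ⊒ s → fromℕ (x ℕ.* y) ⊒ s
  fromℕ-*-⊒ {y} {s} x y⊒s = ⊒-cong (sym (fromℕ-* x y))
    (*-⊒-integral (fromℕ-⊒ x) y⊒s)

  bézout-⊒ : ∀ {s} a b → 1 ℕ.+ a ≡ b → fromℕ a ⊒ s → fromℕ b ⊒ s → 1# ⊒ s
  bézout-⊒ a b 1+a≡b a⊒s b⊒s = ⊒-cong
    (trans (+-congʳ (reflexive (≡.cong fromℕ (≡.sym 1+a≡b))))
           (solve 2 (λ o a → o :+ a :- a := o) refl 1# (fromℕ a)))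
    (sub-⊒ b⊒s a⊒s)

  -- By Bézout, a positive bound shared by `r` and `p` would hold for 1.
  coprime-⋣ : ∀ {r s} → 0 < r → r < p → 0ℚ ℚ.< s → fromℕ r ⊒ s → ¬ fromℕ p ⊒ s
  coprime-⋣ {r} 0<r r<p 0<s r⊒s p⊒s
    with coprime-Bézout (prime⇒coprime p-prime {{ℕ.>-nonZero 0<r}} r<p)
  ... | Bézout.+- x y eq = 1-⋣ 0<s (bézout-⊒ (y ℕ.* r) (x ℕ.* p) eq (fromℕ-*-⊒ y r⊒s) (fromℕ-*-⊒ x p⊒s))
  ... | Bézout.-+ x y eq = 1-⋣ 0<s (bézout-⊒ (x ℕ.* p) (y ℕ.* r) eq (fromℕ-*-⊒ x p⊒s) (fromℕ-*-⊒ y r⊒s))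

  -- A positive bound `s` on `r + a p`, lowered to `min s 1`, also holds for `p`, hence for `r`,
  -- which contradicts `coprime-⋣`.
  v-unit : ∀ {r} a → 0 < r → r < p → v (fromℕ (r ℕ.+ a ℕ.* p)) ≡ [ 0ℚ ]
  v-unit {r} a 0<r r<p = nonpositive (fromℕ-⊒ m) impossible
    where
    m : ℕ
    m = r ℕ.+ a ℕ.* p
    impossible : ∀ {s} → 0ℚ ℚ.< s → ¬ fromℕ m ⊒ s
    impossible {s} 0<s m⊒s = coprime-⋣ 0<r r<p 0<s⊓1 r⊒ p⊒
      where
      0<s⊓1 : 0ℚ ℚ.< s ℚ.⊓ 1ℚ
      0<s⊓1 with ℚ.⊓-sel s 1ℚ
      ... | inj₁ eq = ≡.subst (0ℚ ℚ.<_) (≡.sym eq) 0<s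
      ... | inj₂ eq = ≡.subst (0ℚ ℚ.<_) (≡.sym eq) 0<1ℚ
      p⊒ : fromℕ p ⊒ s ℚ.⊓ 1ℚ
      p⊒ = ⊒-weaken (ℚ.p⊓q≤q s 1ℚ) (v≡⇒⊒ v-p)
      r⊒ : fromℕ r ⊒ s ℚ.⊓ 1ℚ
      r⊒ = ⊒-cong
        (trans (+-congʳ (fromℕ-+ r (a ℕ.* p))) (solve 2 (λ r a → r :+ a :- a := r) refl _ _))
        (sub-⊒ (⊒-weaken (ℚ.p⊓q≤p s 1ℚ) m⊒s) (fromℕ-*-⊒ a p⊒))
    nonpositive : ∀ {x} → x ⊒ 0ℚ → (∀ {s} → 0ℚ ℚ.< s → ¬ x ⊒ s) → v x ≡ [ 0ℚ ]
    nonpositive {x} x⊒0 h with v x in eq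
    ... | ⊤⁺    = contradiction (_ ≤⊤⁺) (h 0<1ℚ)
    ... | [ s ] with x⊒0
    ...   | [ 0≤s ] with s ℚ.≤? 0ℚ
    ...     | yes s≤0 = ≡.cong [_] (ℚ.≤-antisym s≤0 0≤s)
    ...     | no  s≰0 = contradiction [ ℚ.≤-refl ] (h (ℚ.≰⇒> s≰0))

  -- Among 1, …, r + a p only the multiples p, 2p, …, a p are not units.
  v-! : ∀ a r n → n ≡ r ℕ.+ a ℕ.* p → r < p → v (fromℕ (n !)) ≡ v (fromℕ p ^ a * fromℕ (a !))
  v-! zero zero zero n≡ r<p = v-cong (sym (*-identityˡ _))
  v-! (suc a) zero zero n≡ r<p = contradiction (≡.sym n≡) (ℕ.m+1+n≢0 0 ∘ ≡.trans (≡.cong (ℕ._+ a ℕ.* p) (ℕ.suc-pred p)))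
  -- The factor `(a + 1) p` is removed here; the number below it is `(p - 1) + a p`, so the
  -- remainder restarts at `p - 1`.
  v-! (suc a) zero (suc n) n≡ r<p = ≡.trans (v-cong (fromℕ-* (suc n) (n !)))
    (≡.trans (v-* _ _) (≡.trans (≡.cong₂ _+⁺_ (≡.cong (v ∘ fromℕ) n≡) (v-! a (ℕ.pred p) n n≡′ (ℕ.≤-reflexive (ℕ.suc-pred p))))
    (≡.trans (≡.sym (v-* _ _)) (v-cong rearrange))))
    where
    n≡′ : n ≡ ℕ.pred p ℕ.+ a ℕ.* p
    n≡′ = ℕ.suc-injective (≡.trans n≡ (≡.cong (ℕ._+ a ℕ.* p) (≡.sym (ℕ.suc-pred p))))
    rearrange : fromℕ (suc a ℕ.* p) * (fromℕ p ^ a * fromℕ (a !)) ≈ fromℕ p ^ suc a * fromℕ (suc a !)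
    rearrange = begin
      fromℕ (suc a ℕ.* p) * (fromℕ p ^ a * fromℕ (a !))
        ≈⟨ *-congʳ (fromℕ-* (suc a) p) ⟩
      fromℕ (suc a) * fromℕ p * (fromℕ p ^ a * fromℕ (a !))
        ≈⟨ solve 4 (λ a p q f → a :* p :* (q :* f) := p :* q :* (a :* f)) refl (fromℕ (suc a)) _ _ _ ⟩
      fromℕ p ^ suc a * (fromℕ (suc a) * fromℕ (a !))
        ≈⟨ *-congˡ (fromℕ-* (suc a) (a !)) ⟨
      fromℕ p ^ suc a * fromℕ (suc a !) ∎
  v-! a (suc r) (suc n) n≡ r<p = ≡.trans (v-cong (fromℕ-* (suc n) (n !)))
    (≡.trans (v-* _ _) (≡.trans (≡.cong₂ _+⁺_
      (≡.trans (≡.cong (v ∘ fromℕ) n≡) (v-unit a (s≤s z≤n) r<p))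
      (v-! a r n (ℕ.suc-injective n≡) (ℕ.<⇒≤ r<p)))
    ([0]+⁺ _)))

  -- With `a = n / p`, the valuation of `n!` is `a` plus that of `a!`, hence by induction at most
  -- `2 a ≤ n`. A bound linear in `n` is what the powers of `u` can absorb.
  v-!-bound : ∀ n → ∃[ s ] v (fromℕ (n !)) ≡ [ s ] ∧ s ℚ.≤ n · 1ℚ
  v-!-bound = <-rec _ bound
    where
    bound : ∀ n → (∀ {m} → m < n → ∃[ s ] v (fromℕ (m !)) ≡ [ s ] ∧ s ℚ.≤ m · 1ℚ) →
            ∃[ s ] v (fromℕ (n !)) ≡ [ s ] ∧ s ℚ.≤ n · 1ℚ
    bound zero    rec = 0ℚ , ≡.trans (v-cong fromℕ-1) v-1 , ℚ.≤-refl
    bound n@(suc _) rec with s , v≡s , s≤ ← rec {n ℕ./ p} (ℕ.m/n<m n p (ℕ.nonTrivial⇒n>1 p)) =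
      a · 1ℚ ℚ.+ s
      , ≡.trans (v-! a (n ℕ.% p) n (ℕ.m≡m%n+[m/n]*n n p) (ℕ.m%n<n n p)) (v-*-finite (v-^ a v-p) v≡s)
      , ℚ.≤-trans (ℚ.+-monoʳ-≤ (a · 1ℚ) s≤)
          (≡.subst (ℚ._≤ n · 1ℚ) (×-homo-+ 1ℚ a a) (·-monoˡ-≤ 0≤1ℚ a+a≤n))
      where
      a : ℕ
      a = n ℕ./ p
      a+a≤n : a ℕ.+ a ≤ n
      a+a≤n = ℕ.≤-trans (ℕ.≤-reflexive (≡.trans (≡.cong (a ℕ.+_) (≡.sym (ℕ.+-identityʳ a))) (ℕ.*-comm 2 a)))
        (ℕ.≤-trans (ℕ.*-monoʳ-≤ a (ℕ.nonTrivial⇒n>1 p)) (ℕ.m/n*n≤m n p))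

  !⁻¹-⊒ : ∀ n → fromℕ (n !) ⁻¹ ⊒ n · (ℚ.- 1ℚ)
  !⁻¹-⊒ n with s , v≡s , s≤n ← v-!-bound n =
    ⊒-weaken (≡.subst (ℚ._≤ ℚ.- s) (≡.sym (·-neg n 1ℚ)) (ℚ.neg-antimono-≤ s≤n)) (v≡⇒⊒ (v-⁻¹ v≡s))

  -- If `n + 1` were zero, so would be `(n + 1)!`, whose valuation is finite.
  char0 : ∀ n → ¬ fromℕ (suc n) ≈ 0#
  char0 n eq with s , v≡s , _ ← v-!-bound (suc n) =
    finite⇒≉0 v≡s (trans (fromℕ-* (suc n) (n !)) (trans (*-congʳ eq) (zeroˡ _)))

-- The logarithmic and binomial series, and uniqueness of power series.

module PowerSeries {c ℓ} {p : ℕ} (p-prime : Prime p) (ℂₚ : PAdicComplexNumbers p c ℓ) where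
  open CatalanDaehee p-prime ℂₚ renaming (zero to *-zero)
  open FieldLemmas valuedField
  open Inverses valuedField
  open Valuation valuedField
  open FactorialValuation p-prime ℂₚ
  open FiniteSums commutativeRing
  open LogarithmPowers valuedField char0
  open Algebra.Properties.Semiring.Exp semiring using (^-homo-*; ^-congˡ)
  open Algebra.Properties.CommutativeSemiring.Exp commutativeSemiring using (^-distrib-*)
  open import Relation.Binary.Reasoning.Setoid setoid
  open Solver using (solve; _:+_; _:*_; :-_; _:-_; _:=_; con)
  private module ℚS = ℚ.+-*-Solver

  ∑-extend : ∀ {M N} {f : ℕ → Carrier} → M ≤ N → (∀ k → M ≤ k → f k ≈ 0#) → ∑ N f ≈ ∑ M f
  ∑-extend {N = N} z≤n         h = ∑-zero N (λ i _ → h i z≤n)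
  ∑-extend         (s≤s M≤N)   h = +-congˡ (∑-extend M≤N (λ k M≤k → h (suc k) (s≤s M≤k)))

  -- By the ultrametric inequality a block of terms beyond `N` is as small as those terms, so the
  -- partial sums are Cauchy.
  summable : ∀ {a} → Null a → ∃[ s ] HasSum a s
  summable {a} a→0 = complete (λ N → ∑ N a) cauchy
    where
    block : ∀ {r} N → (∀ n → n ≥ N → a n ⊒ r) → ∀ k → ∑ (k ℕ.+ N) a - ∑ N a ⊒ r
    block N h zero    = ≈0⇒⊒ (-‿inverseʳ _)
    block N h (suc k) = ⊒-cong
      (trans (solve 3 (λ x y z → (x :- y) :+ z := x :+ z :- y) refl _ _ _)
             (+-congʳ (sym (∑-snoc (k ℕ.+ N) a))))
      (+-⊒ (block N h k) (h (k ℕ.+ N) (ℕ.m≤n+m N k)))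
    cauchy : IsCauchy (λ N → ∑ N a)
    cauchy r with N , h ← a→0 r = N , λ m n m≥N n≥N → ⊒-cong
      (solve 3 (λ x y z → (x :- z) :- (y :- z) := x :- y) refl _ _ _)
      (sub-⊒ (from m m≥N) (from n n≥N))
      where
      from : ∀ m → m ≥ N → ∑ m a - ∑ N a ⊒ r
      from m m≥N = ≡.subst (λ k → ∑ k a - ∑ N a ⊒ r) (ℕ.m∸n+n≡m m≥N) (block N h (m ∸ N))

  linear⇒Null : ∀ {a t} → 1ℚ ℚ.≤ t → (∀ m → a m ⊒ m · t) → Null a
  linear⇒Null {t = t} 1≤t h r with N , r≤N ← archimedean r = N , λ m m≥N → ⊒-weaken
    (ℚ.≤-trans r≤N (ℚ.≤-trans (·-monoˡ-≤ 0≤1ℚ m≥N) (·-monoʳ-≤ m 1≤t))) (h m)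

  HasSum-head : ∀ {a} → (∀ n → a (suc n) ≈ 0#) → HasSum a (a 0)
  HasSum-head {a} h r = 1 , λ where
    (suc n) _ → ≈0⇒⊒ (trans (+-congʳ (trans (+-congˡ (∑-zero n (λ i _ → h i))) (+-identityʳ _))) (-‿inverseʳ _))

  HasSum-cons : ∀ {a s} → a 0 ≈ 0# → HasSum a s → HasSum (a ∘ suc) s
  HasSum-cons {a} {s} a₀≈0 a→s = HasSum-cong {a ∘ suc} (λ _ → refl)
    (trans (+-congˡ (trans (-‿cong a₀≈0) (solve 0 (:- con (pos 0) := con (pos 0)) refl))) (+-identityʳ s))
    (HasSum-tail {a} a→s)

  -- `(z)ₘ / m!`, left expanded in powers of `z`: both the double series and the final formula ask
  -- for this shape.
  binomial : Carrier → ℕ → Carrier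
  binomial z m = ∑ (suc m) (λ k → z ^ k * logPowCoeff k m)

  logPowCoeff-vanish : ∀ {k m} → m < k → logPowCoeff k m ≈ 0#
  logPowCoeff-vanish m<k = trans (*-congʳ (reflexive (≡.cong fromℤ (S₁-vanish m<k)))) (zeroˡ _)

  logPowCoeff-⊒ : ∀ k m → logPowCoeff k m ⊒ m · (ℚ.- 1ℚ)
  logPowCoeff-⊒ k m = *-⊒-integral (fromℤ-⊒ (S₁ m k)) (!⁻¹-⊒ m)

  -- `1 / (n + 1) = n! / (n + 1)!`, so the bound on inverse factorials applies.
  logCoeff-⊒ : ∀ m → logCoeff m ⊒ m · (ℚ.- 1ℚ)
  logCoeff-⊒ zero    = ≈0⇒⊒ refl
  logCoeff-⊒ (suc n) = *-⊒-integral (⊒-resp (·-zeroʳ n) (^-⊒ n -1-⊒))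
    (⊒-cong n!/[1+n]! (*-⊒-integral (fromℕ-⊒ (n !)) (!⁻¹-⊒ (suc n))))
    where
    n!/[1+n]! : fromℕ (n !) * fromℕ (suc n !) ⁻¹ ≈ fromℕ (suc n) ⁻¹
    n!/[1+n]! = ⁻¹-unique $ begin
      fromℕ (suc n) * (fromℕ (n !) * fromℕ (suc n !) ⁻¹)  ≈⟨ solve 3 (λ a b c → a :* (b :* c) := b :* (a :* c)) refl _ _ _ ⟩
      fromℕ (n !) * (fromℕ (suc n) * fromℕ (suc n !) ⁻¹)  ≈⟨ *-congˡ (suc*!⁻¹ n) ⟩
      fromℕ (n !) * fromℕ (n !) ⁻¹                        ≈⟨ inverseʳ _ (fromℕ-!-nonzero n) ⟩
      1#                                                  ∎

  logTerm-⊒ : ∀ {u t} → u ⊒ 1ℚ ℚ.+ t → ∀ m → logCoeff m * u ^ m ⊒ m · t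
  logTerm-⊒ {u} {t} u⊒ m = ⊒-resp
    (≡.trans (≡.sym (×-distrib-+ (ℚ.- 1ℚ) (1ℚ ℚ.+ t) m))
      (≡.cong (m ·_) (≡.trans (≡.sym (ℚ.+-assoc (ℚ.- 1ℚ) 1ℚ t)) (ℚ.+-identityˡ t))))
    (*-⊒ (logCoeff-⊒ m) (^-⊒ m u⊒))

  -- For `k ≤ m`, `r ≤ 0` turns the bound `k · r` on `zᵏ` into `m · r`; this and the loss from
  -- `1 / m!` are paid by `1 - r` out of each factor `u`. For `k > m` the coefficient is zero.
  expTerm-⊒ : ∀ {z u r t} → r ℚ.≤ 0ℚ → z ⊒ r → u ⊒ (1ℚ ℚ.- r) ℚ.+ t →
              ∀ k m → z ^ k * logPowCoeff k m * u ^ m ⊒ m · t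
  expTerm-⊒ {z} {u} {r} {t} r≤0 z⊒r u⊒ k m with k ℕ.≤? m
  ... | no  k≰m = ≈0⇒⊒ (trans (*-congʳ (trans (*-congˡ (logPowCoeff-vanish (ℕ.≰⇒> k≰m))) (zeroʳ _))) (zeroˡ _))
  ... | yes k≤m = ⊒-resp exponents
    (*-⊒ (*-⊒ (⊒-weaken (·-antimonoˡ-≤ r≤0 k≤m) (^-⊒ k z⊒r)) (logPowCoeff-⊒ k m)) (^-⊒ m u⊒))
    where
    exponents : (m · r ℚ.+ m · (ℚ.- 1ℚ)) ℚ.+ m · ((1ℚ ℚ.- r) ℚ.+ t) ≡ m · t
    exponents = ≡.trans (≡.cong (ℚ._+ m · ((1ℚ ℚ.- r) ℚ.+ t)) (≡.sym (×-distrib-+ r (ℚ.- 1ℚ) m)))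
      (≡.trans (≡.sym (×-distrib-+ (r ℚ.+ ℚ.- 1ℚ) ((1ℚ ℚ.- r) ℚ.+ t) m))
      (≡.cong (m ·_) (ℚS.solve 2 (λ r t → (r ℚS.:+ ℚS.con (ℚ.- 1ℚ)) ℚS.:+ ((ℚS.con 1ℚ ℚS.:- r) ℚS.:+ t) ℚS.:= t) ≡.refl r t)))

  -- Of the bound `1 + 1`, one unit pays for the coefficients and the other makes the terms tend to
  -- zero. `IsLog` starts at the linear term, `logCoeff` at a zero constant term; both forms are
  -- provided.
  log-series : ∀ x → x - 1# ⊒ 1ℚ ℚ.+ 1ℚ →
               ∃[ l ] IsLog x l ∧ HasSum (λ m → logCoeff m * (x - 1#) ^ m) l
  log-series x u⊒ =
    let l , a→l = summable {a} (linear⇒Null {a} {1ℚ} ℚ.≤-refl (logTerm-⊒ {x - 1#} {1ℚ} u⊒))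
    in l , HasSum-cong {a ∘ suc} {s = l} reorder refl (HasSum-cons {a} (zeroˡ _) a→l) , a→l
    where
    a : ℕ → Carrier
    a m = logCoeff m * (x - 1#) ^ m
    reorder : ∀ n → a (suc n) ≈ (- 1#) ^ n * ((x - 1#) ^ suc n / fromℕ (suc n))
    reorder n = solve 3 (λ a b c → a :* b :* c := a :* (c :* b)) refl _ _ _

  ⋆-geometric : ∀ f g u n → ((λ m → f m * u ^ m) ⋆ (λ m → g m * u ^ m)) n ≈ (f ⋆ g) n * u ^ n
  ⋆-geometric f g u n = begin
    ∑ (suc n) (λ i → f i * u ^ i * (g (n ∸ i) * u ^ (n ∸ i))) ≈⟨ ∑-cong (suc n) collect ⟩
    ∑ (suc n) (λ i → f i * g (n ∸ i) * u ^ n)                 ≈⟨ ∑-*ʳ (suc n) (u ^ n) (λ i → f i * g (n ∸ i)) ⟨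
    (f ⋆ g) n * u ^ n                                         ∎
    where
    collect : ∀ i → i < suc n → f i * u ^ i * (g (n ∸ i) * u ^ (n ∸ i)) ≈ f i * g (n ∸ i) * u ^ n
    collect i i≤n = begin
      f i * u ^ i * (g (n ∸ i) * u ^ (n ∸ i))    ≈⟨ solve 4 (λ a b c d → a :* b :* (c :* d) := a :* c :* (b :* d)) refl _ _ _ _ ⟩
      f i * g (n ∸ i) * (u ^ i * u ^ (n ∸ i))    ≈⟨ *-congˡ (^-homo-* u i (n ∸ i)) ⟨
      f i * g (n ∸ i) * u ^ (i ℕ.+ (n ∸ i))      ≡⟨ ≡.cong (λ k → f i * g (n ∸ i) * u ^ k) (ℕ.m+[n∸m]≡n (ℕ.≤-pred i≤n)) ⟩
      f i * g (n ∸ i) * u ^ n                    ∎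

  -- By induction on `k`, multiplying by the logarithm and dividing by `k + 1`.
  logPow-series : ∀ {u l} → HasSum (λ m → logCoeff m * u ^ m) l →
                  ∀ k → HasSum (λ m → logPowCoeff k m * u ^ m) (l ^ k / fromℕ (k !))
  logPow-series {u} {l} h zero = HasSum-cong {λ m → logPowCoeff 0 m * u ^ m} (λ _ → refl)
    (trans (*-identityʳ _) (*-congʳ fromℕ-1))
    (HasSum-head {λ m → logPowCoeff 0 m * u ^ m}
      (λ n → trans (*-congʳ (trans (*-congʳ (reflexive (≡.cong fromℤ (S₁-zero n)))) (zeroˡ _))) (zeroˡ _)))
  logPow-series {u} {l} h (suc k) = HasSum-cong terms value
    (HasSum-* {f ⋆ g} (fromℕ (suc k) ⁻¹) (HasSum-⋆ {f} {g} h (logPow-series h k)))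
    where
    f g : ℕ → Carrier
    f m = logCoeff m * u ^ m
    g m = logPowCoeff k m * u ^ m
    terms : ∀ n → (f ⋆ g) n * fromℕ (suc k) ⁻¹ ≈ logPowCoeff (suc k) n * u ^ n
    terms n = begin
      (f ⋆ g) n * fromℕ (suc k) ⁻¹
        ≈⟨ *-congʳ (trans (⋆-geometric logCoeff (logPowCoeff k) u n) (*-congʳ (log-⋆-logPow k n))) ⟩
      fromℕ (suc k) * logPowCoeff (suc k) n * u ^ n * fromℕ (suc k) ⁻¹
        ≈⟨ solve 4 (λ a b c d → a :* b :* c :* d := a :* d :* (b :* c)) refl (fromℕ (suc k)) _ _ _ ⟩
      fromℕ (suc k) * fromℕ (suc k) ⁻¹ * (logPowCoeff (suc k) n * u ^ n)
        ≈⟨ *-congʳ (inverseʳ _ (char0 k)) ⟩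
      1# * (logPowCoeff (suc k) n * u ^ n)
        ≈⟨ *-identityˡ _ ⟩
      logPowCoeff (suc k) n * u ^ n ∎
    value : l * (l ^ k / fromℕ (k !)) * fromℕ (suc k) ⁻¹ ≈ l ^ suc k / fromℕ (suc k !)
    value = begin
      l * (l ^ k * fromℕ (k !) ⁻¹) * fromℕ (suc k) ⁻¹
        ≈⟨ solve 4 (λ a b c d → a :* (b :* c) :* d := a :* b :* (d :* c)) refl _ _ _ _ ⟩
      l ^ suc k * (fromℕ (suc k) ⁻¹ * fromℕ (k !) ⁻¹)
        ≈⟨ *-congˡ (⁻¹-distrib-* (char0 k) (fromℕ-!-nonzero k)) ⟨
      l ^ suc k * (fromℕ (suc k) * fromℕ (k !)) ⁻¹
        ≈⟨ *-congˡ (⁻¹-cong (fromℕ-* (suc k) (k !))) ⟨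
      l ^ suc k * fromℕ (suc k !) ⁻¹ ∎

  -- The double series is an array whose rows sum to the terms of the exponential and whose columns
  -- are the terms of the binomial series. The limit `e` is obtained from the columns and then
  -- recognised as the exponential. The bound on `e - 1#` holds because only the column `m = 0`
  -- contributes 1; it later keeps the denominator from vanishing.
  exp-series : ∀ {z u l r t} → r ℚ.≤ 0ℚ → 1ℚ ℚ.≤ t → z ⊒ r → u ⊒ (1ℚ ℚ.- r) ℚ.+ t →
               HasSum (λ m → logCoeff m * u ^ m) l →
               ∃[ e ] IsExp (z * l) e ∧ HasSum (λ m → binomial z m * u ^ m) e ∧ e - 1# ⊒ t
  exp-series {z} {u} {l} {r} {t} r≤0 1≤t z⊒r u⊒ hl =
    e , isExp , HasSum-cong {B} (λ m → sym (∑-*ʳ (suc m) (u ^ m) (λ k → z ^ k * logPowCoeff k m))) refl B→e , e-1⊒t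
    where
    T : ℕ → ℕ → Carrier
    T k m = z ^ k * logPowCoeff k m * u ^ m
    T-⊒ : ∀ k m → T k m ⊒ m · t
    T-⊒ = expTerm-⊒ r≤0 z⊒r u⊒
    T-vanish : ∀ {k m} → m < k → T k m ≈ 0#
    T-vanish m<k = trans (*-congʳ (trans (*-congˡ (logPowCoeff-vanish m<k)) (zeroʳ _))) (zeroˡ _)
    B : ℕ → Carrier
    B m = ∑ (suc m) (λ k → T k m)
    B-⊒ : ∀ m → B m ⊒ m · t
    B-⊒ m = ∑-⊒ (suc m) (λ k _ → T-⊒ k m)
    ΣB : ∃[ e ] HasSum B e
    ΣB = summable (linear⇒Null {B} {t} 1≤t B-⊒)
    e : Carrier
    e = proj₁ ΣB
    B→e : HasSum B e
    B→e = proj₂ ΣB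

    E : ℕ → Carrier
    E k = (z * l) ^ k / fromℕ (k !)
    T→E : ∀ k → HasSum (T k) (E k)
    T→E k = HasSum-cong
      (λ m → solve 3 (λ a b c → a :* b :* c := c :* a :* b) refl (logPowCoeff k m) (u ^ m) (z ^ k))
      (trans (solve 3 (λ a b c → a :* b :* c := c :* a :* b) refl _ _ _) (*-congʳ (sym (^-distrib-* z l k))))
      (HasSum-* {λ m → logPowCoeff k m * u ^ m} (z ^ k) (logPow-series hl k))

    -- The rows k < K of the triangular array T sum to E 0 + … + E (K - 1) and the
    -- columns to B, so the difference only involves the columns m ≥ K.
    isExp : IsExp (z * l) e
    isExp R = let N , R≤N = archimedean R in N , λ K K≥N →
      HasSum-⊒ {λ m → ∑ K (λ k → T k m) - B m} (remainder R≤N K K≥N)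
        (HasSum-sub {λ m → ∑ K (λ k → T k m)} {B} (HasSum-∑ K {T} {E} T→E) B→e)
      where
      remainder : ∀ {N} → R ℚ.≤ N · 1ℚ → ∀ K → K ≥ N → ∀ m → ∑ K (λ k → T k m) - B m ⊒ R
      remainder R≤N K K≥N m with K ℕ.≤? m
      ... | yes K≤m = ⊒-weaken
        (ℚ.≤-trans R≤N (ℚ.≤-trans (·-monoˡ-≤ 0≤1ℚ (ℕ.≤-trans K≥N K≤m)) (·-monoʳ-≤ m 1≤t)))
        (sub-⊒ (∑-⊒ K (λ k _ → T-⊒ k m)) (B-⊒ m))
      ... | no  K≰m = ≈0⇒⊒ (trans (+-congʳ (∑-extend (ℕ.≰⇒> K≰m) (λ k m<k → T-vanish m<k))) (-‿inverseʳ _))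

    B₀≈1 : B 0 ≈ 1#
    B₀≈1 = begin
      1# * (fromℕ 1 * fromℕ 1 ⁻¹) * 1# + 0#  ≈⟨ +-identityʳ _ ⟩
      1# * (fromℕ 1 * fromℕ 1 ⁻¹) * 1#       ≈⟨ *-identityʳ _ ⟩
      1# * (fromℕ 1 * fromℕ 1 ⁻¹)            ≈⟨ *-identityˡ _ ⟩
      fromℕ 1 * fromℕ 1 ⁻¹                   ≈⟨ inverseʳ _ (char0 0) ⟩
      1#                                     ∎

    e-1⊒t : e - 1# ⊒ t
    e-1⊒t = ⊒-cong (+-congˡ (-‿cong B₀≈1)) (HasSum-⊒ {B ∘ suc}
      (λ m → ⊒-weaken (≤+nonneg (·-nonneg m (ℚ.≤-trans 0≤1ℚ 1≤t))) (B-⊒ (suc m)))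
      (HasSum-tail {B} B→e))

  -- Its powers are the test points: nonzero and arbitrarily small.
  π : Carrier
  π = fromℕ p

  π^-⊒ : ∀ k → π ^ k ⊒ k · 1ℚ
  π^-⊒ k = v≡⇒⊒ (v-^ k v-p)

  -- The terms at `π ^ T` have a common bound `B`. At `π ^ (T + j)` every term after the first gains
  -- at least `j`, and `a 0` is minus their sum, so `a 0 ⊒ B + j` for all `j`.
  vanishing-head : ∀ {a : ℕ → Carrier} T → (∀ k → T ≤ k → HasSum (λ n → a n * (π ^ k) ^ n) 0#) → a 0 ≈ 0#
  vanishing-head {a} T h = ⊒-all⇒≈0 small
    where
    small : ∀ r → a 0 ⊒ r
    small r with B , bound ← Null-bounded (HasSum⇒Null {λ n → a n * (π ^ T) ^ n} (h T ℕ.≤-refl))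
      with j , r-B≤j ← archimedean (r ℚ.- B) =
      ⊒-cong (trans (solve 2 (λ a o → :- (con (pos 0) :- a :* o) := a :* o) refl (a 0) 1#) (*-identityʳ _))
        (neg-⊒ (HasSum-⊒ {λ n → a (suc n) * (π ^ (T ℕ.+ j)) ^ suc n} tail-⊒
          (HasSum-tail {λ n → a n * (π ^ (T ℕ.+ j)) ^ n} (h (T ℕ.+ j) (ℕ.m≤m+n T j)))))
      where
      split : ∀ n → a n * (π ^ T) ^ n * (π ^ j) ^ n ≈ a n * (π ^ (T ℕ.+ j)) ^ n
      split n = begin
        a n * (π ^ T) ^ n * (π ^ j) ^ n     ≈⟨ *-assoc _ _ _ ⟩
        a n * ((π ^ T) ^ n * (π ^ j) ^ n)   ≈⟨ *-congˡ (^-distrib-* (π ^ T) (π ^ j) n) ⟨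
        a n * (π ^ T * π ^ j) ^ n           ≈⟨ *-congˡ (^-congˡ n (^-homo-* π T j)) ⟨
        a n * (π ^ (T ℕ.+ j)) ^ n           ∎
      r≤B+j : r ℚ.≤ B ℚ.+ j · 1ℚ
      r≤B+j = ≡.subst₂ ℚ._≤_ (r-s+s r B) (ℚ.+-comm (j · 1ℚ) B) (ℚ.+-monoˡ-≤ B r-B≤j)
      tail-⊒ : ∀ n → a (suc n) * (π ^ (T ℕ.+ j)) ^ suc n ⊒ r
      tail-⊒ n = ⊒-cong (split (suc n)) (⊒-weaken
        (ℚ.≤-trans r≤B+j (ℚ.+-monoʳ-≤ B (≤+nonneg (·-nonneg n (·-nonneg j 0≤1ℚ)))))
        (*-⊒ (bound (suc n)) (^-⊒ (suc n) (π^-⊒ j))))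

  -- Once the constant term is zero, the series can be divided by `t = π ^ k`, which is nonzero, and
  -- the quotient vanishes at the same points.
  vanishing : ∀ {a : ℕ → Carrier} T → (∀ k → T ≤ k → HasSum (λ n → a n * (π ^ k) ^ n) 0#) → ∀ n → a n ≈ 0#
  vanishing {a} T h zero    = vanishing-head {a} T h
  vanishing {a} T h (suc n) = vanishing {a ∘ suc} T shifted n
    where
    shifted : ∀ k → T ≤ k → HasSum (λ n → a (suc n) * (π ^ k) ^ n) 0#
    shifted k T≤k = HasSum-cong {λ n → a (suc n) * (t * t ^ n) * t ⁻¹} cancel (zeroˡ _)
      (HasSum-* {λ n → a (suc n) * t ^ suc n} (t ⁻¹)
        (HasSum-cons {λ n → a n * t ^ n} (trans (*-congʳ (vanishing-head {a} T h)) (zeroˡ _)) (h k T≤k)))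
      where
      t : Carrier
      t = π ^ k
      cancel : ∀ n → a (suc n) * (t * t ^ n) * t ⁻¹ ≈ a (suc n) * t ^ n
      cancel n = begin
        a (suc n) * (t * t ^ n) * t ⁻¹   ≈⟨ solve 4 (λ a t s i → a :* (t :* s) :* i := t :* i :* (a :* s)) refl _ _ _ _ ⟩
        t * t ⁻¹ * (a (suc n) * t ^ n)   ≈⟨ *-congʳ (inverseʳ t (finite⇒≉0 (v-^ k v-p))) ⟩
        1# * (a (suc n) * t ^ n)         ≈⟨ *-identityˡ _ ⟩
        a (suc n) * t ^ n                ∎

-- Comparison of the generating functions at the test points.

0≤1/[p-1] : ∀ {p} (p-prime : Prime p) → 0ℚ ℚ.≤ 1/[ p-prime -1]
0≤1/[p-1] {2+ k} _ = ℚ.toℚᵘ-cancel-≤ (ℚᵘ.≤-respʳ-≃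
  (ℚᵘ.≃-sym (ℚ.toℚᵘ-fromℚᵘ (ℚᵘ.mkℚᵘ (pos 1) k))) (ℚᵘ.*≤* (+≤+ z≤n)))
0≤1/[p-1] {0} (prime {{()}} _)
0≤1/[p-1] {1} (prime {{()}} _)

1/[p-1]≤1 : ∀ {p} (p-prime : Prime p) → 1/[ p-prime -1] ℚ.≤ 1ℚ
1/[p-1]≤1 {2+ k} _ = ℚ.toℚᵘ-cancel-≤ (ℚᵘ.≤-respˡ-≃
  (ℚᵘ.≃-sym (ℚ.toℚᵘ-fromℚᵘ (ℚᵘ.mkℚᵘ (pos 1) k))) (ℚᵘ.*≤* (+≤+ (s≤s z≤n))))
1/[p-1]≤1 {0} (prime {{()}} _)
1/[p-1]≤1 {1} (prime {{()}} _)

module GeneratingFunction {c ℓ} {p : ℕ} (p-prime : Prime p) (ℂₚ : PAdicComplexNumbers p c ℓ) where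
  open CatalanDaehee p-prime ℂₚ renaming (zero to *-zero)
  open FieldLemmas valuedField
  open Inverses valuedField
  open Valuation valuedField
  open FactorialValuation p-prime ℂₚ
  open FiniteSums commutativeRing
  open LogarithmPowers valuedField char0
  open PowerSeries p-prime ℂₚ
  open Algebra.Properties.Semiring.Exp semiring using (^-homo-*; ^-assocʳ; ^-congˡ)
  open Algebra.Properties.CommutativeSemiring.Exp commutativeSemiring using (^-distrib-*)
  open import Relation.Binary.Reasoning.Setoid setoid
  open Solver using (solve; _:+_; _:*_; :-_; _:-_; _:=_)

  -4# : Carrier
  -4# = - fromℕ 4

  [1-4t]-1≈-4t : ∀ t → 1-4 t - 1# ≈ -4# * t
  [1-4t]-1≈-4t t = solve 3 (λ o a t → o :- a :* t :- o := (:- a) :* t) refl 1# (fromℕ 4) t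

  1-4t-⊒ : ∀ {t r} → t ⊒ r → 1-4 t - 1# ⊒ r
  1-4t-⊒ {t} t⊒r = ⊒-cong (sym ([1-4t]-1≈-4t t)) (*-⊒-integral (neg-⊒ (fromℕ-⊒ 4)) t⊒r)

  -- `1 / (p - 1) ≤ 1 < 2`; the second power is also where the bound of `log-series` is met.
  π^-InDisc : ∀ k → InDisc (π ^ (2+ k))
  π^-InDisc k = ≡.subst ([ 1/[ p-prime -1] ] <⁺_) (≡.sym (v-^ (2+ k) v-p))
    [ ℚ.≤-<-trans (1/[p-1]≤1 p-prime)
        (ℚ.<-≤-trans (≡.subst (ℚ._< 1ℚ ℚ.+ 1ℚ) (ℚ.+-identityʳ 1ℚ) (ℚ.+-monoʳ-< 1ℚ 0<1ℚ))
                     (ℚ.+-monoʳ-≤ 1ℚ (≤+nonneg (·-nonneg k 0≤1ℚ)))) ]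

  InDisc⇒⊒0 : ∀ {z} → InDisc z → z ⊒ 0ℚ
  InDisc⇒⊒0 {z} z∈D with v z | z∈D
  ... | [ _ ] | [ lt ] = [ ℚ.≤-trans (0≤1/[p-1] p-prime) (ℚ.<⇒≤ lt) ]
  ... | ⊤⁺    | _      = _ ≤⊤⁺

  -- `q - 1 = (q s - 1) - q (s - 1)` with `|q| ≤ 1`. If `q s = 1`, then `q - 1` would be as small as
  -- `s - 1`, beyond its valuation `w`.
  denominator-nonzero : ∀ {q s w t} → InDisc (1# - q) → v (q - 1#) ≡ [ w ] → w ℚ.< t →
                        s - 1# ⊒ t → ¬ q * s - 1# ≈ 0#
  denominator-nonzero {q} {s} {w} {t} q∈D vq≡w w<t s-1⊒t qs≈1 =
    ℚ.<-irrefl ≡.refl (ℚ.<-≤-trans w<t (⊒⇒≤ vq≡w q-1⊒t))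
    where
    q⊒0 : q ⊒ 0ℚ
    q⊒0 = ⊒-cong (solve 2 (λ o q → o :- (o :- q) := q) refl 1# q) (sub-⊒ 1-⊒ (InDisc⇒⊒0 q∈D))
    q-1⊒t : q - 1# ⊒ t
    q-1⊒t = ⊒-cong
      (begin
        (q * s - 1#) - q * (s - 1#)  ≈⟨ solve 3 (λ q s o → (q :* s :- o) :- q :* (s :- o) := q :* o :- o) refl q s 1# ⟩
        q * 1# - 1#                  ≈⟨ +-congʳ (*-identityʳ q) ⟩
        q - 1#                       ∎)
      (sub-⊒ (≈0⇒⊒ qs≈1) (*-⊒-integral q⊒0 s-1⊒t))

  binomialSeries : Carrier → ℕ → Carrier
  binomialSeries z m = binomial z m * -4# ^ m

  coefficient : ∀ {q logq} → InDisc (1# - q) → ¬ q ≈ 1# →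
    (d : ℕ → Carrier) → IsCatalanDaeheeNumbers q logq d →
    (dₓ : ℕ → Carrier → Carrier) → IsCatalanDaeheePolynomials q logq dₓ →
    ∀ x n → dₓ n x ≈ (binomialSeries (x / fromℕ 2) ⋆ d) n
  coefficient {q} {logq} q∈D q≉1 d d-numbers dₓ dₓ-polynomials x n = begin
    dₓ n x                              ≈⟨ solve 2 (λ a b → a := a :- b :+ b) refl _ (b n) ⟩
    dₓ n x - b n + b n                  ≈⟨ +-congʳ (vanishing {λ n → dₓ n x - b n} (2+ T) vanish n) ⟩
    0# + b n                            ≈⟨ +-identityˡ _ ⟩
    b n                                 ∎
    where
    z : Carrier
    z = x / fromℕ 2
    b : ℕ → Carrier
    b = binomialSeries z ⋆ d

    q-1≉0 : ¬ q - 1# ≈ 0#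
    q-1≉0 eq = q≉1 (trans (solve 2 (λ q o → q := q :- o :+ o) refl q 1#) (trans (+-congʳ eq) (+-identityˡ 1#)))
    w : ℚ
    w = proj₁ (v-finite q-1≉0)
    vq≡w : v (q - 1#) ≡ [ w ]
    vq≡w = proj₂ (v-finite q-1≉0)

    B½ Bz r : ℚ
    B½ = proj₁ (bounded ½)
    Bz = proj₁ (bounded z)
    -- One bound for both exponents, `½` of the square root and `z` of the power, and nonpositive as
    -- `exp-series` requires.
    r = 0ℚ ℚ.⊓ (B½ ℚ.⊓ Bz)
    r≤0 : r ℚ.≤ 0ℚ
    r≤0 = ℚ.p⊓q≤p 0ℚ (B½ ℚ.⊓ Bz)
    r≤B½⊓Bz : r ℚ.≤ B½ ℚ.⊓ Bz
    r≤B½⊓Bz = ℚ.p⊓q≤q 0ℚ (B½ ℚ.⊓ Bz)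
    ½⊒r : ½ ⊒ r
    ½⊒r = ⊒-weaken (ℚ.≤-trans r≤B½⊓Bz (ℚ.p⊓q≤p B½ Bz)) (proj₂ (bounded ½))
    z⊒r : z ⊒ r
    z⊒r = ⊒-weaken (ℚ.≤-trans r≤B½⊓Bz (ℚ.p⊓q≤q B½ Bz)) (proj₂ (bounded z))

    J : ℕ
    J = proj₁ (archimedean w)
    τ : ℚ
    -- One more than `J ≥ w`: strictly above `w` for the denominator, and at least 1 for
    -- convergence.
    τ = suc J · 1ℚ
    1≤τ : 1ℚ ℚ.≤ τ
    1≤τ = ≤+nonneg (·-nonneg J 0≤1ℚ)
    w<τ : w ℚ.< τ
    w<τ = ℚ.≤-<-trans (proj₂ (archimedean w))
      (≡.subst (ℚ._< τ) (ℚ.+-identityˡ (J · 1ℚ)) (ℚ.+-monoˡ-< (J · 1ℚ) 0<1ℚ))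

    T : ℕ
    T = proj₁ (archimedean ((1ℚ ℚ.- r) ℚ.+ τ))

    vanish : ∀ k → 2+ T ≤ k → HasSum (λ n → (dₓ n x - b n) * (π ^ k) ^ n) 0#
    vanish (suc zero) (s≤s ())
    vanish k@(2+ k′) T+2≤k = HasSum-cong {λ n → dₓ n x * t ^ n - b n * t ^ n}
      (λ n → solve 3 (λ a b t → a :* t :- b :* t := (a :- b) :* t) refl _ _ _)
      (trans (+-congˡ (-‿cong (*-comm e y))) (-‿inverseʳ _))
      (HasSum-sub {λ n → dₓ n x * t ^ n} {λ n → b n * t ^ n} polynomials product)
      where
      t : Carrier
      t = π ^ k
      u : Carrier
      u = 1-4 t - 1#
      u⊒2 : u ⊒ 1ℚ ℚ.+ 1ℚ
      u⊒2 = 1-4t-⊒ (⊒-weaken (ℚ.+-monoʳ-≤ 1ℚ (≤+nonneg (·-nonneg k′ 0≤1ℚ))) (π^-⊒ k))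
      u⊒ : u ⊒ (1ℚ ℚ.- r) ℚ.+ τ
      u⊒ = 1-4t-⊒ (⊒-weaken
        (ℚ.≤-trans (proj₂ (archimedean ((1ℚ ℚ.- r) ℚ.+ τ))) (·-monoˡ-≤ 0≤1ℚ (ℕ.≤-trans (ℕ.m≤n+m T 2) T+2≤k)))
        (π^-⊒ k))

      logarithm : ∃[ l ] IsLog (1-4 t) l ∧ HasSum (λ m → logCoeff m * u ^ m) l
      logarithm = log-series (1-4 t) u⊒2
      l : Carrier
      l = proj₁ logarithm
      isLog : IsLog (1-4 t) l
      isLog = proj₁ (proj₂ logarithm)
      power : ∀ {z} → z ⊒ r → ∃[ e ] IsExp (z * l) e ∧ HasSum (λ m → binomial z m * u ^ m) e ∧ e - 1# ⊒ τ
      power z⊒r = exp-series r≤0 1≤τ z⊒r u⊒ (proj₂ (proj₂ logarithm))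

      s e y : Carrier
      s = proj₁ (power ½⊒r)
      e = proj₁ (power z⊒r)
      -- The same `l` and `s` feed both hypotheses, so both series are evaluated with one `y` and
      -- their sums can be compared.
      y = ((q - 1#) + (q - 1#) / logq * (½ * l)) / (q * s - 1#)
      generating : GeneratingValue q logq t y
      generating = l , s , isLog , (l , isLog , proj₁ (proj₂ (power ½⊒r))) ,
        denominator-nonzero q∈D vq≡w w<τ (proj₂ (proj₂ (proj₂ (power ½⊒r)))) , refl

      polynomials : HasSum (λ n → dₓ n x * t ^ n) (y * e)
      polynomials = dₓ-polynomials x t y e (π^-InDisc k′) generating (l , isLog , proj₁ (proj₂ (power z⊒r)))
      numbers : HasSum (λ n → d n * t ^ n) y
      numbers = d-numbers t y (π^-InDisc k′) generating
      exponential : HasSum (λ m → binomialSeries z m * t ^ m) e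
      exponential = HasSum-cong {λ m → binomial z m * u ^ m}
        (λ m → trans (*-congˡ (trans (^-congˡ m ([1-4t]-1≈-4t t)) (^-distrib-* -4# t m))) (sym (*-assoc _ _ _)))
        refl (proj₁ (proj₂ (proj₂ (power z⊒r))))
      product : HasSum (λ n → b n * t ^ n) (e * y)
      product = HasSum-cong (⋆-geometric (binomialSeries z) d t) refl
        (HasSum-⋆ {λ m → binomialSeries z m * t ^ m} {λ m → d m * t ^ m} exponential numbers)

  -- Rearrangement into powers of `x`.

  ∑-drop : ∀ l N {f : ℕ → Carrier} → (∀ i → i < l → f i ≈ 0#) → ∑ N f ≈ ∑ (N ∸ l) (λ j → f (l ℕ.+ j))
  ∑-drop zero    N       h = refl
  ∑-drop (suc l) zero    h = refl
  ∑-drop (suc l) (suc N) h = trans (+-congʳ (h 0 (s≤s z≤n)))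
    (trans (+-identityˡ _) (∑-drop l N (λ i i<l → h (suc i) (s≤s i<l))))

  1^n≈1 : ∀ n → 1# ^ n ≈ 1#
  1^n≈1 zero    = refl
  1^n≈1 (suc n) = trans (*-identityˡ _) (1^n≈1 n)

  -4^m : ∀ m → -4# ^ m ≈ (- 1#) ^ m * fromℕ 2 ^ (2 *ℕ m)
  -4^m m = begin
    -4# ^ m                                     ≈⟨ ^-congˡ m -4≈ ⟩
    (- 1# * fromℕ 2 ^ 2) ^ m                    ≈⟨ ^-distrib-* (- 1#) (fromℕ 2 ^ 2) m ⟩
    (- 1#) ^ m * (fromℕ 2 ^ 2) ^ m              ≈⟨ *-congˡ (^-assocʳ (fromℕ 2) 2 m) ⟩
    (- 1#) ^ m * fromℕ 2 ^ (2 *ℕ m)             ∎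
    where
    -4≈ : -4# ≈ - 1# * fromℕ 2 ^ 2
    -4≈ = begin
      - fromℕ 4                           ≈⟨ -‿cong (fromℕ-* 2 2) ⟩
      - (fromℕ 2 * fromℕ 2)               ≈⟨ -‿cong (*-identityˡ _) ⟨
      - (1# * (fromℕ 2 * fromℕ 2))        ≈⟨ solve 2 (λ o a → :- (o :* a) := (:- o) :* a) refl 1# _ ⟩
      - 1# * (fromℕ 2 * fromℕ 2)          ≈⟨ *-congˡ (*-congˡ (*-identityʳ _)) ⟨
      - 1# * fromℕ 2 ^ 2                  ∎

  -- `l ≤ m` ensures `l ≤ 2 m`, so the truncated subtraction in the exponent is exact.
  2^[2m]/2^l : ∀ {l m} → l ≤ m → fromℕ 2 ^ (2 *ℕ m) * (fromℕ 2 ⁻¹) ^ l ≈ fromℕ 2 ^ (2 *ℕ m ∸ l)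
  2^[2m]/2^l {l} {m} l≤m = begin
    two ^ (2 *ℕ m) * (two ⁻¹) ^ l                    ≡⟨ ≡.cong (λ k → two ^ k * (two ⁻¹) ^ l) (ℕ.m∸n+n≡m (ℕ.≤-trans l≤m (ℕ.m≤m+n m _))) ⟨
    two ^ (2 *ℕ m ∸ l ℕ.+ l) * (two ⁻¹) ^ l          ≈⟨ *-congʳ (^-homo-* two (2 *ℕ m ∸ l) l) ⟩
    two ^ (2 *ℕ m ∸ l) * two ^ l * (two ⁻¹) ^ l      ≈⟨ *-assoc _ _ _ ⟩
    two ^ (2 *ℕ m ∸ l) * (two ^ l * (two ⁻¹) ^ l)    ≈⟨ *-congˡ (^-distrib-* two (two ⁻¹) l) ⟨
    two ^ (2 *ℕ m ∸ l) * (two * two ⁻¹) ^ l        ≈⟨ *-congˡ (trans (^-congˡ l (inverseʳ two (char0 1))) (1^n≈1 l)) ⟩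
    two ^ (2 *ℕ m ∸ l) * 1#                        ≈⟨ *-identityʳ _ ⟩
    two ^ (2 *ℕ m ∸ l)                             ∎
    where
    two : Carrier
    two = fromℕ 2

  module _ (d : ℕ → Carrier) (n : ℕ) (x : Carrier) where

    coeff : ℕ → ℕ → Carrier
    coeff l m = (- 1#) ^ m * (fromℕ 2 ^ (2 *ℕ m ∸ l) / fromℕ (m !)) * fromℤ (S₁ m l) * d (n ∸ m)

    term : ℕ → ℕ → Carrier
    term l m = (x / fromℕ 2) ^ l * logPowCoeff l m * -4# ^ m * d (n ∸ m)

    coeff-vanish : ∀ {l m} → m < l → coeff l m ≈ 0#
    coeff-vanish {l} {m} m<l = begin
      _ * fromℤ (S₁ m l) * d (n ∸ m)  ≈⟨ *-congʳ (*-congˡ (reflexive (≡.cong fromℤ (S₁-vanish m<l)))) ⟩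
      _ * 0# * d (n ∸ m)              ≈⟨ *-congʳ (zeroʳ _) ⟩
      0# * d (n ∸ m)                  ≈⟨ zeroˡ _ ⟩
      0#                              ∎

    term-vanish : ∀ {l m} → m < l → term l m ≈ 0#
    term-vanish {l} {m} m<l = begin
      (x / fromℕ 2) ^ l * logPowCoeff l m * -4# ^ m * d (n ∸ m)
        ≈⟨ *-congʳ (*-congʳ (trans (*-congˡ (logPowCoeff-vanish m<l)) (zeroʳ _))) ⟩
      0# * -4# ^ m * d (n ∸ m)
        ≈⟨ trans (*-congʳ (zeroˡ _)) (zeroˡ _) ⟩
      0# ∎

    -- For `l > m`, where the exponent `2 m ∸ l` may be truncated, both sides vanish together with
    -- `S₁ m l`.
    term≈coeff : ∀ l m → term l m ≈ coeff l m * x ^ l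
    term≈coeff l m with l ℕ.≤? m
    ... | no  l≰m = trans (term-vanish (ℕ.≰⇒> l≰m)) (sym (trans (*-congʳ (coeff-vanish (ℕ.≰⇒> l≰m))) (zeroˡ _)))
    ... | yes l≤m = begin
      (x * fromℕ 2 ⁻¹) ^ l * (S * i) * -4# ^ m * D
        ≈⟨ *-congʳ (*-cong (*-congʳ (^-distrib-* x (fromℕ 2 ⁻¹) l)) (-4^m m)) ⟩
      x ^ l * (fromℕ 2 ⁻¹) ^ l * (S * i) * ((- 1#) ^ m * fromℕ 2 ^ (2 *ℕ m)) * D
        ≈⟨ regroup (x ^ l) ((fromℕ 2 ⁻¹) ^ l) S i ((- 1#) ^ m) (fromℕ 2 ^ (2 *ℕ m)) D ⟩
      (- 1#) ^ m * (fromℕ 2 ^ (2 *ℕ m) * (fromℕ 2 ⁻¹) ^ l * i) * S * D * x ^ l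
        ≈⟨ *-congʳ (*-congʳ (*-congʳ (*-congˡ (*-congʳ (2^[2m]/2^l l≤m))))) ⟩
      (- 1#) ^ m * (fromℕ 2 ^ (2 *ℕ m ∸ l) * i) * S * D * x ^ l ∎
      where
      S i D : Carrier
      S = fromℤ (S₁ m l)
      i = fromℕ (m !) ⁻¹
      D = d (n ∸ m)
      regroup : ∀ X h s i e t D → X * h * (s * i) * (e * t) * D ≈ e * (t * h * i) * s * D * X
      regroup = solve 7 (λ X h s i e t D →
        X :* h :* (s :* i) :* (e :* t) :* D := e :* (t :* h :* i) :* s :* D :* X) refl

    -- Since `S₁ m l` vanishes for `m < l`, the triangle `l ≤ m ≤ n` can be filled up to a square,
    -- the two sums exchanged, and the inner one cut back to `m ≥ l`.
    rearrangement : (binomialSeries (x / fromℕ 2) ⋆ d) n ≈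
                    ∑[ l from 0 to n ] ((∑[ m from l to n ] coeff l m) * x ^ l)
    rearrangement = begin
      ∑ (suc n) (λ m → binomial z m * -4# ^ m * d (n ∸ m))
        ≈⟨ ∑-cong (suc n) (λ m m≤n → trans (expand m) (sym (∑-extend m≤n (λ l m<l → term-vanish m<l)))) ⟩
      ∑ (suc n) (λ m → ∑ (suc n) (λ l → term l m))
        ≈⟨ ∑-swap (suc n) (suc n) (λ m l → term l m) ⟩
      ∑ (suc n) (λ l → ∑ (suc n) (term l))
        ≈⟨ ∑-cong (suc n) (λ l _ → trans (∑-cong (suc n) (λ m _ → term≈coeff l m)) (sym (∑-*ʳ (suc n) (x ^ l) (coeff l)))) ⟩
      ∑ (suc n) (λ l → ∑ (suc n) (coeff l) * x ^ l)
        ≈⟨ ∑-cong (suc n) (λ l _ → *-congʳ {x ^ l} (∑-drop l (suc n) (λ m m<l → coeff-vanish m<l))) ⟩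
      ∑ (suc n) (λ l → ∑ (suc n ∸ l) (λ j → coeff l (l ℕ.+ j)) * x ^ l) ∎
      where
      z : Carrier
      z = x / fromℕ 2
      expand : ∀ m → binomial z m * -4# ^ m * d (n ∸ m) ≈ ∑ (suc m) (λ l → term l m)
      expand m = begin
        binomial z m * -4# ^ m * d (n ∸ m)
          ≈⟨ *-congʳ (∑-*ʳ (suc m) (-4# ^ m) (λ l → z ^ l * logPowCoeff l m)) ⟩
        ∑ (suc m) (λ l → z ^ l * logPowCoeff l m * -4# ^ m) * d (n ∸ m)
          ≈⟨ ∑-*ʳ (suc m) (d (n ∸ m)) (λ l → z ^ l * logPowCoeff l m * -4# ^ m) ⟩
        ∑ (suc m) (λ l → term l m) ∎

theorem5 : ∀ {c ℓ : Level} (p : ℕ) (p-prime : Prime p) → ¬ (2 ∣ p) →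
    (ℂₚ : PAdicComplexNumbers p c ℓ) →
    let open CatalanDaehee p-prime ℂₚ in
    ∀ (q logq : Carrier) → InDisc (1# - q) → ¬ (q ≈ 1#) → IsLog q logq →
    (d : ℕ → Carrier) → IsCatalanDaeheeNumbers q logq d →
    (dₓ : ℕ → Carrier → Carrier) → IsCatalanDaeheePolynomials q logq dₓ →
    ∀ (n : ℕ) (x : Carrier) →
    dₓ n x ≈ ∑[ l from 0 to n ]
    ((∑[ m from l to n ]
    ((- 1#) ^ m * (fromℕ 2 ^ (2 *ℕ m ∸ l) / fromℕ (m !)) * fromℤ (S₁ m l) * d (n ∸ m)))
    * x ^ l)
theorem5 p p-prime _ ℂₚ q logq q∈D q≉1 _ d d-numbers dₓ dₓ-polynomials n x =
  trans (coefficient q∈D q≉1 d d-numbers dₓ dₓ-polynomials x n) (rearrangement d n x)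
  where
  open CatalanDaehee p-prime ℂₚ using (trans)
  open GeneratingFunction p-prime ℂₚ
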